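{- Let $X^*$ be uniform in $\{0,1\}^n$; for each $t=1,\dots,T$ let $U_t$ be an independent uniform vector in $\{0,1\}^{\alpha n}$; let $M_1,\dots,M_T$ be independent uniformly random matchings on $[n]$ of size $\alpha n$. Let $S^Y_0=S^N_0=0$ and for $t=1,\dots,T$ let $S^Y_t=r_t(M_{1:t},S^Y_{1:t-1},M_tX^*)$ and $S^N_t=r_t(M_{1:t},S^N_{1:t-1},U_t)$ for some functions $r_t$. Suppose there are events $\mathcal E_1\supset\mathcal E_2\supset\dots\supset\mathcal E_T$, with $\mathcal E_t$ depending only on $M_{1:t}$ and $S^Y_{1:t-1}$ and $\Pr[\mathcal E_1]=1$, and $\gamma>0$, such that for every fixed $M_{1:t},S^Y_{1:t-1}$ satisfying $\mathcal E_t$, \[\|S^Y_t-r_t(M_{1:t},S^Y_{1:t-1},U_t)\|_{tvd}\le\gamma/T\] (the distributions being conditional on the fixed values), and such that $\Pr[\bar{\mathcal E}_t\mid\mathcal E_{t-1}]\le\gamma/T$ for each $t$. Then \[\|(M_{1:T},S^Y_{1:T})-(M_{1:T},S^N_{1:T})\|_{tvd}\le2\gamma.\]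
   Context: $J_{1:t}$ denotes $(J_1,\dots,J_t)$. $M_tX^*\in\{0,1\}^{\alpha n}$ is the vector $(X^*_a+X^*_b\bmod2)_{(a,b)\in M_t}$. The total variation distance between random variables $X,Y$ on a finite space is $\frac12\sum_\omega|\Pr[X=\omega]-\Pr[Y=\omega]|$. -}

module Defs where

open import Data.Bool using (Bool; true; false; not; _∧_; _xor_; if_then_else_)
open import Data.Nat as ℕ using (ℕ; zero; suc; _≤_; _<_; _^_; NonZero)
open import Data.Nat.Properties using (≤-trans; n≤1+n; ≤-refl; <⇒≤)
open import Data.Fin as Fin using (Fin; toℕ; fromℕ<)
open import Data.Fin.Properties using (toℕ<n; toℕ-fromℕ<) renaming (_≟_ to _≟F_)
open import Data.Product using (_×_; _,_; proj₁; proj₂)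
open import Data.List as L using (List; []; _∷_; length; filterᵇ; cartesianProduct; concatMap; allFin)
open import Data.Vec as V using (Vec; []; _∷_; lookup; _∷ʳ_)
import Data.Vec.Properties as VP
import Data.Product.Properties as PP
open import Data.Integer using (+_)
open import Data.Rational using (ℚ; 0ℚ; _/_; _+_; _-_; _*_; ∣_∣; ½)
open import Relation.Nullary.Decidable using (⌊_⌋)
open import Relation.Binary.PropositionalEquality using (_≡_; sym)

allVecs : {A : Set} → List A → (j : ℕ) → List (Vec A j)
allVecs xs zero = [] ∷ []
allVecs xs (suc j) = L.map (λ p → proj₁ p ∷ proj₂ p) (cartesianProduct xs (allVecs xs j))

-- bit vectors {0,1}^k  (false = 0, true = 1)
Bits : ℕ → Set
Bits k = Vec Bool k

allBits : (k : ℕ) → List (Bits k)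
allBits k = allVecs (true ∷ false ∷ []) k

-- Matchings on [n] of size m, given as an (ordered) list of m pairs
-- whose 2m endpoints are pairwise distinct.

Matching : ℕ → ℕ → Set
Matching n m = Vec (Fin n × Fin n) m

memᵇ : {n : ℕ} → Fin n → List (Fin n) → Bool
memᵇ a [] = false
memᵇ a (b ∷ bs) = if ⌊ a ≟F b ⌋ then true else memᵇ a bs

distinctᵇ : {n : ℕ} → List (Fin n) → Bool
distinctᵇ [] = true
distinctᵇ (a ∷ as) = not (memᵇ a as) ∧ distinctᵇ as

endpoints : {n m : ℕ} → Matching n m → List (Fin n)
endpoints M = concatMap (λ p → proj₁ p ∷ proj₂ p ∷ []) (V.toList M)

isMatching : {n m : ℕ} → Matching n m → Bool
isMatching M = distinctᵇ (endpoints M)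

allMatchings : (n m : ℕ) → List (Matching n m)
allMatchings n m = filterᵇ isMatching (allVecs (cartesianProduct (allFin n) (allFin n)) m)

-- M X : the vector (X_a + X_b mod 2)_{(a,b) ∈ M}
applyM : {n m : ℕ} → Matching n m → Bits n → Bits m
applyM M x = V.map (λ p → lookup x (proj₁ p) xor lookup x (proj₂ p)) M

eqMatchings : {n m j : ℕ} → Vec (Matching n m) j → Vec (Matching n m) j → Bool
eqMatchings A B = ⌊ VP.≡-dec (VP.≡-dec (PP.≡-dec _≟F_ _≟F_)) A B ⌋

eqStates : {k j : ℕ} → Vec (Fin k) j → Vec (Fin k) j → Bool
eqStates A B = ⌊ VP.≡-dec _≟F_ A B ⌋

countᵇ : {A : Set} → (A → Bool) → List A → ℕ
countᵇ p xs = length (filterᵇ p xs)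

-- a / b as a rational (with the convention a / 0 = 0, never used
-- on realisable events)
ratio : ℕ → ℕ → ℚ
ratio a zero = 0ℚ
ratio a (suc b) = + a / suc b

Pr : {A : Set} → List A → (A → Bool) → ℚ
Pr Ω E = ratio (countᵇ E Ω) (length Ω)

PrCond : {A : Set} → List A → (A → Bool) → (A → Bool) → ℚ
PrCond Ω E F = ratio (countᵇ (λ ω → E ω ∧ F ω) Ω) (countᵇ F Ω)

sumℚ : {A : Set} → List A → (A → ℚ) → ℚ
sumℚ [] f = 0ℚ
sumℚ (x ∷ xs) f = f x + sumℚ xs f

-- total variation distance of two distributions on a finite space
-- (enumerated without repetition by the list)
tvd : {A : Set} → List A → (A → ℚ) → (A → ℚ) → ℚ
tvd space P Q = ½ * sumℚ space (λ ω → ∣ P ω - Q ω ∣)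

-- The protocol.  Time steps t = 1..T are indexed by Fin T (index i ↔ t = i+1).
-- States S_t take values in Fin k.
-- r i : (M_1..M_{i+1}) → (S_1..S_i) → {0,1}^m → Fin k

Rounds : (n m k T : ℕ) → Set
Rounds n m k T = (i : Fin T) → Vec (Matching n m) (suc (toℕ i)) → Vec (Fin k) (toℕ i) → Bits m → Fin k

-- events E_{i+1} depending on M_{1:i+1} and S_{1:i}
Events : (n m k T : ℕ) → Set
Events n m k T = (i : Fin T) → Vec (Matching n m) (suc (toℕ i)) → Vec (Fin k) (toℕ i) → Bool

prefix : {A : Set} {T : ℕ} → Vec A T → (j : ℕ) → j ≤ T → Vec A j
prefix v zero p = []
prefix {T = T} v (suc j) p = prefix v j (≤-trans (n≤1+n j) p) ∷ʳ lookup v (fromℕ< p)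

-- S_{1:j} computed from the matchings and the inputs fed at each round:
-- S_{i+1} = r_{i+1}(M_{1:i+1}, S_{1:i}, inp_{i+1})
run : {n m k T : ℕ} → Rounds n m k T → Vec (Matching n m) T → Vec (Bits m) T →
      (j : ℕ) → j ≤ T → Vec (Fin k) j
run r ms inp zero p = []
run r ms inp (suc j) p =
  prev ∷ʳ r i (prefix ms (suc (toℕ i)) (toℕ<n i)) (V.cast (sym (toℕ-fromℕ< p)) prev) (lookup inp i)
  where
    i = fromℕ< p
    prev = run r ms inp j (≤-trans (n≤1+n j) p)

-- The probability space: X* ∈ {0,1}^n, U_1..U_T ∈ {0,1}^m, M_1..M_T
-- matchings of size m on [n], all independent and uniform, i.e. the
-- uniform distribution on the following finite list.

Ω : (n m T : ℕ) → Set
Ω n m T = Bits n × Vec (Bits m) T × Vec (Matching n m) T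

allΩ : (n m T : ℕ) → List (Ω n m T)
allΩ n m T = cartesianProduct (allBits n) (cartesianProduct (allVecs (allBits m) T) (allVecs (allMatchings n m) T))

Xof : {n m T : ℕ} → Ω n m T → Bits n
Xof ω = proj₁ ω

Uof : {n m T : ℕ} → Ω n m T → Vec (Bits m) T
Uof ω = proj₁ (proj₂ ω)

Mof : {n m T : ℕ} → Ω n m T → Vec (Matching n m) T
Mof ω = proj₂ (proj₂ ω)

SY : {n m k T : ℕ} → Rounds n m k T → Ω n m T → (j : ℕ) → j ≤ T → Vec (Fin k) j
SY r ω = run r (Mof ω) (V.map (λ M → applyM M (Xof ω)) (Mof ω))

SN : {n m k T : ℕ} → Rounds n m k T → Ω n m T → (j : ℕ) → j ≤ T → Vec (Fin k) j
SN r ω = run r (Mof ω) (Uof ω)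

Mhist : {n m T : ℕ} → Ω n m T → (i : Fin T) → Vec (Matching n m) (suc (toℕ i))
Mhist ω i = prefix (Mof ω) (suc (toℕ i)) (toℕ<n i)

-- S^Y_{1:i}  (i.e. S^Y_{1:t-1} for t = i+1)
SYhist : {n m k T : ℕ} → Rounds n m k T → Ω n m T → (i : Fin T) → Vec (Fin k) (toℕ i)
SYhist r ω i = SY r ω (toℕ i) (<⇒≤ (toℕ<n i))

SYat : {n m k T : ℕ} → Rounds n m k T → Ω n m T → Fin T → Fin k
SYat {T = T} r ω i = lookup (SY r ω T ≤-refl) i

Eω : {n m k T : ℕ} → Rounds n m k T → Events n m k T → Fin T → Ω n m T → Bool
Eω r E i ω = E i (Mhist ω i) (SYhist r ω i)

fixedHist : {n m k T : ℕ} → Rounds n m k T → (i : Fin T) →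
            Vec (Matching n m) (suc (toℕ i)) → Vec (Fin k) (toℕ i) → Ω n m T → Bool
fixedHist r i Mh sh ω = eqMatchings (Mhist ω i) Mh ∧ eqStates (SYhist r ω i) sh

condDistY : {n m k T : ℕ} → Rounds n m k T → (i : Fin T) →
            Vec (Matching n m) (suc (toℕ i)) → Vec (Fin k) (toℕ i) → Fin k → ℚ
condDistY {n} {m} {T = T} r i Mh sh σ =
  PrCond (allΩ n m T) (λ ω → ⌊ SYat r ω i ≟F σ ⌋) (fixedHist r i Mh sh)

distN : {n m k T : ℕ} → Rounds n m k T → (i : Fin T) →
        Vec (Matching n m) (suc (toℕ i)) → Vec (Fin k) (toℕ i) → Fin k → ℚ
distN {m = m} r i Mh sh σ = Pr (allBits m) (λ u → ⌊ r i Mh sh u ≟F σ ⌋)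

jointSpace : (n m k T : ℕ) → List (Vec (Matching n m) T × Vec (Fin k) T)
jointSpace n m k T = cartesianProduct (allVecs (allMatchings n m) T) (allVecs (allFin k) T)

jointY : {n m k T : ℕ} → Rounds n m k T → Vec (Matching n m) T × Vec (Fin k) T → ℚ
jointY {n} {m} {T = T} r v =
  Pr (allΩ n m T) (λ ω → eqMatchings (Mof ω) (proj₁ v) ∧ eqStates (SY r ω T ≤-refl) (proj₂ v))

jointN : {n m k T : ℕ} → Rounds n m k T → Vec (Matching n m) T × Vec (Fin k) T → ℚ
jointN {n} {m} {T = T} r v =
  Pr (allΩ n m T) (λ ω → eqMatchings (Mof ω) (proj₁ v) ∧ eqStates (SN r ω T ≤-refl) (proj₂ v))

_/ℕ_ : ℚ → (T : ℕ) → .{{_ : NonZero T}} → ℚ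
γ /ℕ T = γ * (+ 1 / T)

module Submission where

-- All probabilities are ratios of counts over the finite uniform space Ω of
-- triples (X*, U_{1:T}, M_{1:T}).  For a matching sequence M and states
-- s ∈ [k]^j let countY/countN be the number of points whose YES/NO process
-- has history (M, s).
--  * Chain rule: appending a state σ multiplies countY by the conditional law
--    of S^Y_{j+1} given (M_{1:j+1}, S^Y_{1:j} = s), and countN by the law of
--    r_{j+1}(M_{1:j+1}, s, U) with U uniform; the latter because the round-(j+1)
--    input of the NO process is a fresh coordinate of U.
--  * Hybrid: keep the YES count only on histories along which 𝓔_1, …, 𝓔_j all
--    held.  One round increases its ℓ₁ distance to the NO counts by at most
--    2·(γ/T)·|Ω| (the conditional TVD hypothesis) plus the mass leaving the
--    good events, which is at most (γ/T)·|Ω| by Pr[¬𝓔_{t+1} | 𝓔_t] ≤ γ/T and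
--    Pr[𝓔_1] = 1.  After T rounds the distance is ≤ 3γ|Ω|, and the YES counts
--    differ from the hybrid by at most the γ|Ω| non-good points, so the TVD is
--    at most ½ · 4γ = 2γ.

module Counting where

  open import Data.Bool using (Bool; true; false; not; _∧_; T?)
  open import Data.Nat using (ℕ; zero; suc; _+_; _*_; _≤_; z≤n; s≤s)
  open import Data.Nat.Properties
  open import Data.Nat.Solver using (module +-*-Solver)
  open import Data.Fin using (Fin)
  open import Data.Product using (_×_; _,_; proj₁; proj₂)
  open import Data.List as L using (List; []; _∷_; _++_; length; cartesianProduct)
  open import Data.List.Relation.Unary.All using (All; []; _∷_)
  open import Data.List.Relation.Unary.AllPairs using ([]; _∷_)
  open import Data.List.Relation.Unary.Unique.Propositional using (Unique)
  import Data.List.Relation.Unary.Unique.Propositional.Properties as Unique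
  open import Data.Vec using (Vec; []; _∷_; lookup; _[_]≔_)
  import Data.Vec.Properties as VP
  open import Relation.Binary.Definitions using (DecidableEquality)
  open import Relation.Binary.PropositionalEquality
  open import Relation.Nullary using (yes; no; ¬_)
  open import Relation.Nullary.Decidable using (⌊_⌋)
  open import Data.Empty using (⊥-elim)
  open import Defs using (countᵇ; allVecs; allMatchings; isMatching)

  𝟙 : Bool → ℕ
  𝟙 true = 1
  𝟙 false = 0

  sumℕ : {A : Set} → List A → (A → ℕ) → ℕ
  sumℕ [] f = 0
  sumℕ (x ∷ xs) f = f x + sumℕ xs f

  count≡sum : {A : Set} (P : A → Bool) (xs : List A) → countᵇ P xs ≡ sumℕ xs (λ x → 𝟙 (P x))
  count≡sum P [] = refl
  count≡sum P (x ∷ xs) with P x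
  ... | true = cong suc (count≡sum P xs)
  ... | false = count≡sum P xs

  sumℕ-cong : {A : Set} (xs : List A) {f g : A → ℕ} → (∀ x → f x ≡ g x) → sumℕ xs f ≡ sumℕ xs g
  sumℕ-cong [] e = refl
  sumℕ-cong (x ∷ xs) e = cong₂ _+_ (e x) (sumℕ-cong xs e)

  sumℕ-mono : {A : Set} (xs : List A) {f g : A → ℕ} → (∀ x → f x ≤ g x) → sumℕ xs f ≤ sumℕ xs g
  sumℕ-mono [] e = z≤n
  sumℕ-mono (x ∷ xs) e = +-mono-≤ (e x) (sumℕ-mono xs e)

  sumℕ-++ : {A : Set} (xs ys : List A) (f : A → ℕ) → sumℕ (xs ++ ys) f ≡ sumℕ xs f + sumℕ ys f
  sumℕ-++ [] ys f = refl
  sumℕ-++ (x ∷ xs) ys f = trans (cong (f x +_) (sumℕ-++ xs ys f)) (sym (+-assoc (f x) _ _))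

  sumℕ-map : {A B : Set} (g : A → B) (xs : List A) (f : B → ℕ) → sumℕ (L.map g xs) f ≡ sumℕ xs (λ x → f (g x))
  sumℕ-map g [] f = refl
  sumℕ-map g (x ∷ xs) f = cong (f (g x) +_) (sumℕ-map g xs f)

  sumℕ-× : {A B : Set} (xs : List A) (ys : List B) (f : A × B → ℕ) →
    sumℕ (cartesianProduct xs ys) f ≡ sumℕ xs (λ x → sumℕ ys (λ y → f (x , y)))
  sumℕ-× [] ys f = refl
  sumℕ-× (x ∷ xs) ys f =
    trans (sumℕ-++ (L.map (x ,_) ys) _ f) (cong₂ _+_ (sumℕ-map (x ,_) ys f) (sumℕ-× xs ys f))

  sumℕ-+ : {A : Set} (xs : List A) (f g : A → ℕ) → sumℕ xs (λ x → f x + g x) ≡ sumℕ xs f + sumℕ xs g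
  sumℕ-+ [] f g = refl
  sumℕ-+ (x ∷ xs) f g rewrite sumℕ-+ xs f g =
    solve 4 (λ a b c d → (a :+ b) :+ (c :+ d) := (a :+ c) :+ (b :+ d)) refl (f x) (g x) (sumℕ xs f) (sumℕ xs g)
    where open +-*-Solver

  sumℕ-*ˡ : {A : Set} (c : ℕ) (xs : List A) (f : A → ℕ) → sumℕ xs (λ x → c * f x) ≡ c * sumℕ xs f
  sumℕ-*ˡ c [] f = sym (*-zeroʳ c)
  sumℕ-*ˡ c (x ∷ xs) f = trans (cong (c * f x +_) (sumℕ-*ˡ c xs f)) (sym (*-distribˡ-+ c (f x) _))

  sumℕ-*ʳ : {A : Set} (xs : List A) (f : A → ℕ) (c : ℕ) → sumℕ xs (λ x → f x * c) ≡ sumℕ xs f * c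
  sumℕ-*ʳ xs f c = trans (sumℕ-cong xs (λ x → *-comm (f x) c)) (trans (sumℕ-*ˡ c xs f) (*-comm c _))

  sumℕ-const : {A : Set} (xs : List A) (c : ℕ) → sumℕ xs (λ _ → c) ≡ length xs * c
  sumℕ-const [] c = refl
  sumℕ-const (x ∷ xs) c = cong (c +_) (sumℕ-const xs c)

  sumℕ-swap : {A B : Set} (xs : List A) (ys : List B) (f : A → B → ℕ) →
    sumℕ xs (λ x → sumℕ ys (f x)) ≡ sumℕ ys (λ y → sumℕ xs (λ x → f x y))
  sumℕ-swap [] ys f = sym (trans (sumℕ-const ys 0) (*-zeroʳ (length ys)))
  sumℕ-swap (x ∷ xs) ys f = trans (cong (sumℕ ys (f x) +_) (sumℕ-swap xs ys f)) (sym (sumℕ-+ ys (f x) _))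

  sumℕ-allVecs-suc : {A : Set} (xs : List A) (j : ℕ) (f : Vec A (suc j) → ℕ) →
    sumℕ (allVecs xs (suc j)) f ≡ sumℕ xs (λ x → sumℕ (allVecs xs j) (λ w → f (x ∷ w)))
  sumℕ-allVecs-suc xs j f = trans (sumℕ-map _ (cartesianProduct xs (allVecs xs j)) f) (sumℕ-× xs (allVecs xs j) _)

  count-cong : {A : Set} (P Q : A → Bool) (xs : List A) → (∀ x → P x ≡ Q x) → countᵇ P xs ≡ countᵇ Q xs
  count-cong P Q xs h = trans (count≡sum P xs) (trans (sumℕ-cong xs (λ x → cong 𝟙 (h x))) (sym (count≡sum Q xs)))

  count-mono : {A : Set} (P Q : A → Bool) (xs : List A) → (∀ x → P x ≡ true → Q x ≡ true) →
    countᵇ P xs ≤ countᵇ Q xs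
  count-mono P Q [] h = z≤n
  count-mono P Q (x ∷ xs) h with P x in eP | Q x in eQ
  ... | true | true = s≤s (count-mono P Q xs h)
  ... | true | false with () ← trans (sym (h x eP)) eQ
  ... | false | true = m≤n⇒m≤1+n (count-mono P Q xs h)
  ... | false | false = count-mono P Q xs h

  count≤length : {A : Set} (P : A → Bool) (xs : List A) → countᵇ P xs ≤ length xs
  count≤length P [] = z≤n
  count≤length P (x ∷ xs) with P x
  ... | true = s≤s (count≤length P xs)
  ... | false = m≤n⇒m≤1+n (count≤length P xs)

  count-false : {A : Set} (xs : List A) → countᵇ (λ _ → false) xs ≡ 0
  count-false [] = refl
  count-false (x ∷ xs) = count-false xs

  count-complement : {A : Set} (P : A → Bool) (xs : List A) → countᵇ P xs + countᵇ (λ x → not (P x)) xs ≡ length xs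
  count-complement P [] = refl
  count-complement P (x ∷ xs) with P x
  ... | true = cong suc (count-complement P xs)
  ... | false = trans (+-suc _ _) (cong suc (count-complement P xs))

  count-union : {A : Set} (a b : A → Bool) (xs : List A) →
    countᵇ (λ x → not (a x ∧ b x)) xs ≤ countᵇ (λ x → not (a x)) xs + countᵇ (λ x → a x ∧ not (b x)) xs
  count-union a b [] = z≤n
  count-union a b (x ∷ xs) with a x | b x
  ... | true | true = count-union a b xs
  ... | true | false = subst (suc (countᵇ (λ x → not (a x ∧ b x)) xs) ≤_) (sym (+-suc _ _)) (s≤s (count-union a b xs))
  ... | false | _ = s≤s (count-union a b xs)

  count-≡-unique : {A : Set} (_≟_ : DecidableEquality A) (a : A) (xs : List A) → Unique xs →
    countᵇ (λ y → ⌊ a ≟ y ⌋) xs ≤ 1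
  count-≡-unique _≟_ a [] u = z≤n
  count-≡-unique _≟_ a (x ∷ xs) (a∉ ∷ u) with a ≟ x
  ... | yes refl = s≤s (≤-reflexive (absent xs a∉))
    where
    absent : (ys : List _) → All (λ z → ¬ (a ≡ z)) ys → countᵇ (λ y → ⌊ a ≟ y ⌋) ys ≡ 0
    absent [] h = refl
    absent (y ∷ ys) (a≢y ∷ h) with a ≟ y
    ... | yes e = ⊥-elim (a≢y e)
    ... | no _ = absent ys h
  ... | no _ = count-≡-unique _≟_ a xs u

  allVecs-unique : {A : Set} (xs : List A) → Unique xs → (j : ℕ) → Unique (allVecs xs j)
  allVecs-unique xs u zero = [] ∷ []
  allVecs-unique xs u (suc j) = Unique.map⁺ ∷-injective′ (Unique.cartesianProduct⁺ u (allVecs-unique xs u j))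
    where
    ∷-injective′ : {A : Set} {j : ℕ} {p p′ : A × Vec A j} → (proj₁ p ∷ proj₂ p) ≡ (proj₁ p′ ∷ proj₂ p′) → p ≡ p′
    ∷-injective′ {p = a , w} {a′ , w′} e with VP.∷-injective e
    ... | refl , refl = refl

  matchingVecs-unique : (n m T : ℕ) → Unique (allVecs (allMatchings n m) T)
  matchingVecs-unique n m T = allVecs-unique _ (Unique.filter⁺ (λ M → T? (isMatching M))
    (allVecs-unique _ (Unique.cartesianProduct⁺ (Unique.allFin⁺ n) (Unique.allFin⁺ n)) m)) T

  indicator-sum-const : {A : Set} (xs : List A) (R : A → Bool) (g : A → ℕ) → (∀ x y → g x ≡ g y) →
    sumℕ xs (λ x → 𝟙 (R x) * g x) * length xs ≡ sumℕ xs g * countᵇ R xs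
  indicator-sum-const [] R g g-const = refl
  indicator-sum-const xs@(x₀ ∷ _) R g g-const = begin
      sumℕ xs (λ x → 𝟙 (R x) * g x) * length xs
    ≡⟨ cong (_* length xs) (trans (sumℕ-cong xs (λ x → cong (𝟙 (R x) *_) (g-const x x₀))) (sumℕ-*ʳ xs (λ x → 𝟙 (R x)) (g x₀))) ⟩
      sumℕ xs (λ x → 𝟙 (R x)) * g x₀ * length xs
    ≡⟨ cong (λ c → c * g x₀ * length xs) (sym (count≡sum R xs)) ⟩
      countᵇ R xs * g x₀ * length xs
    ≡⟨ solve 3 (λ a b c → a :* b :* c := c :* b :* a) refl (countᵇ R xs) (g x₀) (length xs) ⟩
      length xs * g x₀ * countᵇ R xs
    ≡⟨ cong (_* countᵇ R xs) (trans (sym (sumℕ-const xs (g x₀))) (sumℕ-cong xs (λ x → g-const x₀ x))) ⟩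
      sumℕ xs g * countᵇ R xs
    ∎
    where
    open ≡-Reasoning
    open +-*-Solver

  -- This is the independence of the i-th fresh input from everything else.
  coordinate-independence : {A : Set} (xs : List A) (T : ℕ) (i : Fin T) (R : A → Bool) (h : Vec A T → ℕ) →
    (∀ v a → h (v [ i ]≔ a) ≡ h v) →
    sumℕ (allVecs xs T) (λ v → 𝟙 (R (lookup v i)) * h v) * length xs ≡ sumℕ (allVecs xs T) h * countᵇ R xs
  coordinate-independence {A} xs (suc T) Fin.zero R h inv = begin
      sumℕ (allVecs xs (suc T)) (λ v → 𝟙 (R (lookup v Fin.zero)) * h v) * length xs
    ≡⟨ cong (_* length xs) (trans (sumℕ-allVecs-suc xs T _) (sumℕ-cong xs (λ x → sumℕ-*ˡ (𝟙 (R x)) (allVecs xs T) (H x)))) ⟩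
      sumℕ xs (λ x → 𝟙 (R x) * sumℕ (allVecs xs T) (H x)) * length xs
    ≡⟨ indicator-sum-const xs R (λ x → sumℕ (allVecs xs T) (H x)) (λ x y → sumℕ-cong (allVecs xs T) (λ w → inv (y ∷ w) x)) ⟩
      sumℕ xs (λ x → sumℕ (allVecs xs T) (H x)) * countᵇ R xs
    ≡⟨ cong (_* countᵇ R xs) (sym (sumℕ-allVecs-suc xs T h)) ⟩
      sumℕ (allVecs xs (suc T)) h * countᵇ R xs
    ∎
    where
    open ≡-Reasoning
    H : A → Vec A T → ℕ
    H x w = h (x ∷ w)
  coordinate-independence xs (suc T) (Fin.suc i) R h inv = begin
      sumℕ (allVecs xs (suc T)) (λ v → 𝟙 (R (lookup v (Fin.suc i))) * h v) * length xs
    ≡⟨ cong (_* length xs) (sumℕ-allVecs-suc xs T _) ⟩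
      sumℕ xs (λ x → sumℕ (allVecs xs T) (λ w → 𝟙 (R (lookup w i)) * h (x ∷ w))) * length xs
    ≡⟨ sym (sumℕ-*ʳ xs _ (length xs)) ⟩
      sumℕ xs (λ x → sumℕ (allVecs xs T) (λ w → 𝟙 (R (lookup w i)) * h (x ∷ w)) * length xs)
    ≡⟨ sumℕ-cong xs (λ x → coordinate-independence xs T i R (λ w → h (x ∷ w)) (λ v a → inv (x ∷ v) a)) ⟩
      sumℕ xs (λ x → sumℕ (allVecs xs T) (λ w → h (x ∷ w)) * countᵇ R xs)
    ≡⟨ trans (sumℕ-*ʳ xs _ (countᵇ R xs)) (cong (_* countᵇ R xs) (sym (sumℕ-allVecs-suc xs T h))) ⟩
      sumℕ (allVecs xs (suc T)) h * countᵇ R xs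
    ∎
    where open ≡-Reasoning


module BooleanEvents where

  open import Data.Bool using (Bool; true; false; _∧_)
  open import Data.Bool.Properties using (∧-comm; ∧-assoc)
  open import Data.Nat using (ℕ; _*_)
  open import Data.Nat.Properties using (+-identityʳ)
  open import Data.Fin using (Fin)
  open import Data.Fin.Properties using () renaming (_≟_ to _≟F_)
  open import Data.Vec as V using (Vec; _∷ʳ_)
  import Data.Vec.Properties as VP
  open import Data.Product using (_,_)
  import Data.Product.Properties as PP
  open import Relation.Binary.Definitions using (DecidableEquality)
  open import Relation.Binary.PropositionalEquality
  open import Relation.Nullary using (Dec; yes; no)
  open import Relation.Nullary.Decidable using (⌊_⌋)
  open import Data.Empty using (⊥-elim)
  open import Defs using (Matching; eqMatchings; eqStates)
  open Counting using (𝟙)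

  dec-true : {A : Set} {x y : A} (d : Dec (x ≡ y)) → ⌊ d ⌋ ≡ true → x ≡ y
  dec-true (yes e) _ = e

  true-dec : {A : Set} {x y : A} (d : Dec (x ≡ y)) → x ≡ y → ⌊ d ⌋ ≡ true
  true-dec (yes e) _ = refl
  true-dec (no x≢y) e = ⊥-elim (x≢y e)

  ∧-intro : {a b : Bool} → a ≡ true → b ≡ true → (a ∧ b) ≡ true
  ∧-intro refl refl = refl

  ∧-elimˡ : (a b : Bool) → (a ∧ b) ≡ true → a ≡ true
  ∧-elimˡ true b _ = refl

  ∧-elimʳ : (a b : Bool) → (a ∧ b) ≡ true → b ≡ true
  ∧-elimʳ true b e = e

  bool-ext : (b b′ : Bool) → (b ≡ true → b′ ≡ true) → (b′ ≡ true → b ≡ true) → b ≡ b′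
  bool-ext false false f g = refl
  bool-ext false true f g = g refl
  bool-ext true false f g = sym (f refl)
  bool-ext true true f g = refl

  𝟙-∧-guarded : (e b b′ : Bool) → (e ≡ true → b ≡ b′) → 𝟙 (e ∧ b) ≡ 𝟙 e * 𝟙 b′
  𝟙-∧-guarded false b b′ f = refl
  𝟙-∧-guarded true b b′ f rewrite f refl = sym (+-identityʳ (𝟙 b′))

  𝟙-∧-≟ : {A : Set} (_≟_ : DecidableEquality A) (x y : A) (Q : A → Bool) → 𝟙 (⌊ x ≟ y ⌋ ∧ Q x) ≡ 𝟙 ⌊ x ≟ y ⌋ * 𝟙 (Q y)
  𝟙-∧-≟ _≟_ x y Q = 𝟙-∧-guarded ⌊ x ≟ y ⌋ (Q x) (Q y) (λ e → cong Q (dec-true (x ≟ y) e))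

  𝟙-∧-comm : (a b : Bool) → 𝟙 (a ∧ b) ≡ 𝟙 b * 𝟙 a
  𝟙-∧-comm false false = refl
  𝟙-∧-comm false true = refl
  𝟙-∧-comm true false = refl
  𝟙-∧-comm true true = refl

  ∧-rotate : (a b c : Bool) → (a ∧ (b ∧ c)) ≡ (b ∧ (c ∧ a))
  ∧-rotate a b c = trans (∧-comm a (b ∧ c)) (∧-assoc b c a)

  _≟M_ : {n m j : ℕ} → DecidableEquality (Vec (Matching n m) j)
  _≟M_ = VP.≡-dec (VP.≡-dec (PP.≡-dec _≟F_ _≟F_))

  eqMatchings-sound : {n m j : ℕ} {A B : Vec (Matching n m) j} → eqMatchings A B ≡ true → A ≡ B
  eqMatchings-sound {A = A} {B} = dec-true (A ≟M B)

  eqMatchings-complete : {n m j : ℕ} {A B : Vec (Matching n m) j} → A ≡ B → eqMatchings A B ≡ true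
  eqMatchings-complete {A = A} {B} = true-dec (A ≟M B)

  eqStates-sound : {k j : ℕ} {A B : Vec (Fin k) j} → eqStates A B ≡ true → A ≡ B
  eqStates-sound {A = A} {B} = dec-true (VP.≡-dec _≟F_ A B)

  eqStates-complete : {k j : ℕ} {A B : Vec (Fin k) j} → A ≡ B → eqStates A B ≡ true
  eqStates-complete {A = A} {B} = true-dec (VP.≡-dec _≟F_ A B)

  eqStates-∷ʳ : {k j : ℕ} (A B : Vec (Fin k) j) (x y : Fin k) → eqStates (A ∷ʳ x) (B ∷ʳ y) ≡ (eqStates A B ∧ ⌊ x ≟F y ⌋)
  eqStates-∷ʳ A B x y = bool-ext _ _
    (λ e → let (A≡B , x≡y) = VP.∷ʳ-injective A B (eqStates-sound e) in ∧-intro (eqStates-complete A≡B) (true-dec (x ≟F y) x≡y))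
    (λ e → eqStates-complete (cong₂ _∷ʳ_ (eqStates-sound (∧-elimˡ _ _ e)) (dec-true (x ≟F y) (∧-elimʳ _ _ e))))

  eqStates-cast : {k a b : ℕ} (e : a ≡ b) (A B : Vec (Fin k) a) → eqStates (V.cast e A) (V.cast e B) ≡ eqStates A B
  eqStates-cast refl A B rewrite VP.cast-is-id refl A | VP.cast-is-id refl B = refl


module Runs where

  open import Data.Nat using (ℕ; zero; suc; _≤_; _<_)
  open import Data.Nat.Properties
  open import Data.Fin as Fin using (Fin; toℕ; fromℕ<)
  open import Data.Fin.Properties using (toℕ<n; toℕ-fromℕ<; toℕ-injective)
  open import Data.Product using (_,_)
  open import Data.Sum using (inj₁; inj₂)
  open import Data.Vec as V using (Vec; []; _∷_; lookup; _∷ʳ_)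
  import Data.Vec.Properties as VP
  open import Relation.Binary.PropositionalEquality
  open import Defs

  lookup-∷ʳ-last : {A : Set} {n : ℕ} (xs : Vec A n) (x : A) (i : Fin (suc n)) → toℕ i ≡ n → lookup (xs ∷ʳ x) i ≡ x
  lookup-∷ʳ-last [] x Fin.zero e = refl
  lookup-∷ʳ-last (y ∷ xs) x (Fin.suc i) e = lookup-∷ʳ-last xs x i (suc-injective e)

  lookup-∷ʳ-init : {A : Set} {n : ℕ} (xs : Vec A n) (x : A) (i : Fin (suc n)) (i′ : Fin n) → toℕ i ≡ toℕ i′ →
    lookup (xs ∷ʳ x) i ≡ lookup xs i′
  lookup-∷ʳ-init (y ∷ xs) x Fin.zero Fin.zero e = refl
  lookup-∷ʳ-init (y ∷ xs) x (Fin.suc i) (Fin.suc i′) e = lookup-∷ʳ-init xs x i i′ (suc-injective e)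

  family-cast : {A : Set} {T : ℕ} (F : (a : ℕ) → a ≤ T → Vec A a) → (∀ a q q′ → F a q ≡ F a q′) →
    ∀ {a b} (e : a ≡ b) (qa : a ≤ T) (qb : b ≤ T) → F b qb ≡ V.cast e (F a qa)
  family-cast F irr refl qa qb = trans (irr _ qb qa) (sym (VP.cast-is-id refl _))

  index-irrelevant : {B : Set} {T : ℕ} (F : (a : ℕ) → a < T → B) → ∀ {a b} (e : a ≡ b) (qa : a < T) (qb : b < T) → F a qa ≡ F b qb
  index-irrelevant F refl qa qb rewrite <-irrelevant qa qb = refl

  Agree : {A : Set} {T : ℕ} → Vec A T → Vec A T → ℕ → Set
  Agree {T = T} v w len = (i : Fin T) → toℕ i < len → lookup v i ≡ lookup w i

  Agree-≤ : {A : Set} {T : ℕ} (v w : Vec A T) {a b : ℕ} → a ≤ b → Agree v w b → Agree v w a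
  Agree-≤ v w a≤b ag i lt = ag i (≤-trans lt a≤b)

  prefix-agree : {A : Set} {T : ℕ} (v w : Vec A T) (a : ℕ) (p : a ≤ T) → Agree v w a → prefix v a p ≡ prefix w a p
  prefix-agree v w zero p ag = refl
  prefix-agree v w (suc a) p ag =
    cong₂ _∷ʳ_ (prefix-agree v w a _ (Agree-≤ v w (n≤1+n a) ag))
               (ag (fromℕ< p) (≤-reflexive (cong suc (toℕ-fromℕ< p))))

  agree-prefix : {A : Set} {T : ℕ} (v w : Vec A T) (a : ℕ) (p : a ≤ T) → prefix v a p ≡ prefix w a p → Agree v w a
  agree-prefix v w (suc a) p e i lt with VP.∷ʳ-injective _ _ e | m≤n⇒m<n∨m≡n (≤-pred lt)
  ... | init≡ , _ | inj₁ lt′ = agree-prefix v w a _ init≡ i lt′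
  ... | _ , last≡ | inj₂ eq = subst (λ z → lookup v z ≡ lookup w z) (toℕ-injective (trans (toℕ-fromℕ< p) (sym eq))) last≡

  module _ {n m k T : ℕ} (r : Rounds n m k T) where

    run-irrelevant : (ms : Vec (Matching n m) T) (inp : Vec (Bits m) T) (j : ℕ) (p q : j ≤ T) → run r ms inp j p ≡ run r ms inp j q
    run-irrelevant ms inp j p q rewrite ≤-irrelevant p q = refl

    runStep : (ms : Vec (Matching n m) T) (inp : Vec (Bits m) T) (j : ℕ) → j < T → Fin k
    runStep ms inp j p = r (fromℕ< p) (prefix ms (suc (toℕ (fromℕ< p))) (toℕ<n (fromℕ< p)))
                           (V.cast (sym (toℕ-fromℕ< p)) (run r ms inp j (≤-trans (n≤1+n j) p))) (lookup inp (fromℕ< p))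

    run-∷ʳ : (ms : Vec (Matching n m) T) (inp : Vec (Bits m) T) (j : ℕ) (p : suc j ≤ T) (q : j ≤ T) →
             run r ms inp (suc j) p ≡ run r ms inp j q ∷ʳ runStep ms inp j p
    run-∷ʳ ms inp j p q = cong (_∷ʳ runStep ms inp j p) (run-irrelevant ms inp j _ q)

    run-local : (ms ms′ : Vec (Matching n m) T) (inp inp′ : Vec (Bits m) T) (len : ℕ) (q : len ≤ T) →
                Agree ms ms′ len → Agree inp inp′ len → run r ms inp len q ≡ run r ms′ inp′ len q
    run-local ms ms′ inp inp′ zero q _ _ = refl
    run-local ms ms′ inp inp′ (suc j) q agM agI =
      cong₂ _∷ʳ_ past≡ (cong₃ (r i) prefix≡ (cong (V.cast (sym ti)) past≡) (agI i (≤-reflexive (cong suc ti))))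
      where
      i : Fin T
      i = fromℕ< q
      ti : toℕ i ≡ j
      ti = toℕ-fromℕ< q
      past≡ : run r ms inp j (≤-trans (n≤1+n j) q) ≡ run r ms′ inp′ j (≤-trans (n≤1+n j) q)
      past≡ = run-local ms ms′ inp inp′ j _ (Agree-≤ ms ms′ (n≤1+n j) agM) (Agree-≤ inp inp′ (n≤1+n j) agI)
      prefix≡ : prefix ms (suc (toℕ i)) (toℕ<n i) ≡ prefix ms′ (suc (toℕ i)) (toℕ<n i)
      prefix≡ = prefix-agree ms ms′ _ _ (Agree-≤ ms ms′ (≤-reflexive (cong suc ti)) agM)
      cong₃ : ∀ {A B C D : Set} (f : A → B → C → D) {a a′ b b′ c c′} → a ≡ a′ → b ≡ b′ → c ≡ c′ → f a b c ≡ f a′ b′ c′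
      cong₃ f refl refl refl = refl

    lookup-run : (ms : Vec (Matching n m) T) (inp : Vec (Bits m) T) (len : ℕ) (q : len ≤ T) (idx : Fin len) →
                 lookup (run r ms inp len q) idx ≡ runStep ms inp (toℕ idx) (<-≤-trans (toℕ<n idx) q)
    lookup-run ms inp (suc j) q idx with m≤n⇒m<n∨m≡n (≤-pred (toℕ<n idx))
    ... | inj₂ eq = trans (lookup-∷ʳ-last past (runStep ms inp j q) idx eq) (index-irrelevant (runStep ms inp) (sym eq) q _)
      where
      past : Vec (Fin k) j
      past = run r ms inp j (≤-trans (n≤1+n j) q)
    ... | inj₁ lt = trans (lookup-∷ʳ-init past (runStep ms inp j q) idx (fromℕ< lt) (sym (toℕ-fromℕ< lt)))
                          (trans (lookup-run ms inp j (≤-trans (n≤1+n j) q) (fromℕ< lt)) (index-irrelevant (runStep ms inp) (toℕ-fromℕ< lt) _ _))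
      where
      past : Vec (Fin k) j
      past = run r ms inp j (≤-trans (n≤1+n j) q)

    inputsY : Bits n → Vec (Matching n m) T → Vec (Bits m) T
    inputsY x M = V.map (λ N → applyM N x) M

    inputsY-agree : (x : Bits n) (M M′ : Vec (Matching n m) T) (len : ℕ) → Agree M M′ len → Agree (inputsY x M) (inputsY x M′) len
    inputsY-agree x M M′ len ag idx lt =
      trans (VP.lookup-map idx _ M) (trans (cong (λ N → applyM N x) (ag idx lt)) (sym (VP.lookup-map idx _ M′)))

    runStep-at : (ms M : Vec (Matching n m) T) (inp : Vec (Bits m) T) (j : ℕ) (p : j < T) (q : j ≤ T) (s : Vec (Fin k) j) →
      ms ≡ M → run r ms inp j q ≡ s →
      runStep ms inp j p ≡ r (fromℕ< p) (prefix M (suc (toℕ (fromℕ< p))) (toℕ<n (fromℕ< p))) (V.cast (sym (toℕ-fromℕ< p)) s) (lookup inp (fromℕ< p))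
    runStep-at ms .ms inp j p q s refl e rewrite run-irrelevant ms inp j (≤-trans (n≤1+n j) p) q | e = refl


module Rationals where

  open import Data.Nat as ℕ using (ℕ; zero; suc; z≤n; s≤s)
  import Data.Nat.Properties as ℕP
  open import Data.Integer as ℤ using (ℤ; +_; +≤+)
  import Data.Integer.Properties as ℤP
  open import Data.Rational using (ℚ; 0ℚ; 1ℚ; ½; _/_; _+_; _*_; _-_; -_; _≤_; toℚᵘ; ∣_∣; nonNegative)
  open import Data.Rational.Properties
  open import Data.Rational.Solver using (module +-*-Solver)
  open import Data.Rational.Unnormalised using (mkℚᵘ; *≡*; *≤*) renaming (_≃_ to _≃ᵘ_)
  import Data.Rational.Unnormalised.Properties as ℚᵘ
  open import Data.Product using (Σ; _×_; _,_)
  open import Data.List as L using (List; []; _∷_; _++_; cartesianProduct)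
  open import Data.Vec using (Vec; []; _∷_; _∷ʳ_)
  open import Relation.Binary.PropositionalEquality
  open import Defs using (ratio; sumℚ; allVecs)
  open Counting using (sumℕ)

  ℕq : ℕ → ℚ
  ℕq a = + a / 1

  IsSuc : ℕ → Set
  IsSuc N = Σ ℕ (λ b → N ≡ suc b)

  -- computations with ℕq go through unnormalised rationals, where z / (b+1) is mkℚᵘ z b
  toℚᵘ-/ : (z : ℤ) (b : ℕ) → toℚᵘ (z / suc b) ≃ᵘ mkℚᵘ z b
  toℚᵘ-/ z b = toℚᵘ-fromℚᵘ (mkℚᵘ z b)

  +*+ : (a b : ℕ) → + a ℤ.* + b ≡ + (a ℕ.* b)
  +*+ a b = sym (ℤP.pos-* a b)

  ℕq-+ : (a b : ℕ) → ℕq (a ℕ.+ b) ≡ ℕq a + ℕq b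
  ℕq-+ a b = toℚᵘ-injective (ℚᵘ.≃-trans (toℚᵘ-/ (+ (a ℕ.+ b)) 0) (ℚᵘ.≃-sym (ℚᵘ.≃-trans (toℚᵘ-homo-+ (ℕq a) (ℕq b))
     (ℚᵘ.≃-trans (ℚᵘ.+-cong (toℚᵘ-/ (+ a) 0) (toℚᵘ-/ (+ b) 0)) (*≡* eq)))))
    where
    eq : (+ a ℤ.* + 1 ℤ.+ + b ℤ.* + 1) ℤ.* + 1 ≡ + (a ℕ.+ b) ℤ.* + 1
    eq rewrite +*+ a 1 | +*+ b 1 | sym (ℤP.pos-+ (a ℕ.* 1) (b ℕ.* 1)) | +*+ (a ℕ.* 1 ℕ.+ b ℕ.* 1) 1 | +*+ (a ℕ.+ b) 1 =
      cong +_ (cong (ℕ._* 1) (cong₂ ℕ._+_ (ℕP.*-identityʳ a) (ℕP.*-identityʳ b)))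

  ℕq-* : (a b : ℕ) → ℕq (a ℕ.* b) ≡ ℕq a * ℕq b
  ℕq-* a b = toℚᵘ-injective (ℚᵘ.≃-trans (toℚᵘ-/ (+ (a ℕ.* b)) 0) (ℚᵘ.≃-sym (ℚᵘ.≃-trans (toℚᵘ-homo-* (ℕq a) (ℕq b))
     (ℚᵘ.≃-trans (ℚᵘ.*-cong (toℚᵘ-/ (+ a) 0) (toℚᵘ-/ (+ b) 0)) (*≡* eq)))))
    where
    eq : (+ a ℤ.* + b) ℤ.* + 1 ≡ + (a ℕ.* b) ℤ.* + 1
    eq rewrite +*+ a b = refl

  ℕq-mono : {a b : ℕ} → a ℕ.≤ b → ℕq a ≤ ℕq b
  ℕq-mono {a} {b} a≤b = toℚᵘ-cancel-≤ (ℚᵘ.≤-respʳ-≃ (ℚᵘ.≃-sym (toℚᵘ-/ (+ b) 0)) (ℚᵘ.≤-respˡ-≃ (ℚᵘ.≃-sym (toℚᵘ-/ (+ a) 0)) (*≤* le)))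
    where
    le : + a ℤ.* + 1 ℤ.≤ + b ℤ.* + 1
    le rewrite +*+ a 1 | +*+ b 1 = +≤+ (ℕP.*-monoˡ-≤ 1 a≤b)

  ℕq-injective : {a b : ℕ} → ℕq a ≡ ℕq b → a ≡ b
  ℕq-injective {a} {b} e with ℚᵘ.≃-trans (ℚᵘ.≃-sym (toℚᵘ-/ (+ a) 0)) (ℚᵘ.≃-trans (toℚᵘ-cong e) (toℚᵘ-/ (+ b) 0))
  ... | *≡* eq rewrite +*+ a 1 | +*+ b 1 = trans (sym (ℕP.*-identityʳ a)) (trans (ℤP.+-injective eq) (ℕP.*-identityʳ b))

  ratio-scale : (a b : ℕ) → ratio a (suc b) ≡ ℕq a * ratio 1 (suc b)
  ratio-scale a b = toℚᵘ-injective (ℚᵘ.≃-trans (toℚᵘ-/ (+ a) b) (ℚᵘ.≃-sym (ℚᵘ.≃-trans (toℚᵘ-homo-* (ℕq a) (ratio 1 (suc b)))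
     (ℚᵘ.≃-trans (ℚᵘ.*-cong (toℚᵘ-/ (+ a) 0) (toℚᵘ-/ (+ 1) b)) (*≡* eq)))))
    where
    eq : (+ a ℤ.* + 1) ℤ.* + suc b ≡ + a ℤ.* + suc (b ℕ.+ 0)
    eq rewrite +*+ a 1 | +*+ (a ℕ.* 1) (suc b) | +*+ a (suc (b ℕ.+ 0)) | ℕP.+-identityʳ b | ℕP.*-identityʳ a = refl

  ratio-cancel : (a b : ℕ) → ratio a (suc b) * ℕq (suc b) ≡ ℕq a
  ratio-cancel a b = toℚᵘ-injective (ℚᵘ.≃-trans (toℚᵘ-homo-* (ratio a (suc b)) (ℕq (suc b)))
     (ℚᵘ.≃-trans (ℚᵘ.*-cong (toℚᵘ-/ (+ a) b) (toℚᵘ-/ (+ suc b) 0)) (ℚᵘ.≃-trans (*≡* eq) (ℚᵘ.≃-sym (toℚᵘ-/ (+ a) 0)))))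
    where
    eq : (+ a ℤ.* + suc b) ℤ.* + 1 ≡ + a ℤ.* + suc (b ℕ.* 1)
    eq rewrite +*+ a (suc b) | +*+ (a ℕ.* suc b) 1 | +*+ a (suc (b ℕ.* 1)) | ℕP.*-identityʳ b | ℕP.*-identityʳ (a ℕ.* suc b) = refl

  ratio-nonneg : (a d : ℕ) → 0ℚ ≤ ratio a d
  ratio-nonneg a zero = ≤-refl
  ratio-nonneg a (suc b) = nonNegative⁻¹ (+ a / suc b) {{normalize-nonNeg a (suc b)}}

  ℕq-nonneg : (a : ℕ) → 0ℚ ≤ ℕq a
  ℕq-nonneg a = ratio-nonneg a 1

  ratio≡1 : (c N : ℕ) → ratio c N ≡ 1ℚ → IsSuc N × c ≡ N
  ratio≡1 c zero e with () ← ℕq-injective {0} {1} e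
  ratio≡1 c (suc b) e = (b , refl) , ℕq-injective (trans (sym (ratio-cancel c b)) (trans (cong (_* ℕq (suc b)) e) (*-identityˡ _)))

  ratio-cross-suc : (x y G b : ℕ) → x ℕ.* suc b ≡ y ℕ.* G → ℕq x ≡ ℕq y * ratio G (suc b)
  ratio-cross-suc x y G b e = sym (begin
      ℕq y * ratio G (suc b)
    ≡⟨ cong (ℕq y *_) (ratio-scale G b) ⟩
      ℕq y * (ℕq G * w)
    ≡⟨ trans (sym (*-assoc (ℕq y) (ℕq G) w)) (cong (_* w) (sym (ℕq-* y G))) ⟩
      ℕq (y ℕ.* G) * w
    ≡⟨ cong (λ z → ℕq z * w) (sym e) ⟩
      ℕq (x ℕ.* suc b) * w
    ≡⟨ trans (cong (_* w) (ℕq-* x (suc b))) (*-assoc (ℕq x) (ℕq (suc b)) w) ⟩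
      ℕq x * (ℕq (suc b) * w)
    ≡⟨ cong (ℕq x *_) (trans (*-comm (ℕq (suc b)) w) (ratio-cancel 1 b)) ⟩
      ℕq x * 1ℚ
    ≡⟨ *-identityʳ (ℕq x) ⟩
      ℕq x
    ∎)
    where
    open ≡-Reasoning
    w : ℚ
    w = ratio 1 (suc b)

  ratio-cross-pos : (x y G L : ℕ) → IsSuc L → x ℕ.* L ≡ y ℕ.* G → ℕq x ≡ ℕq y * ratio G L
  ratio-cross-pos x y G .(suc b) (b , refl) e = ratio-cross-suc x y G b e

  ratio-cross : (x y G F : ℕ) → x ℕ.≤ F → y ℕ.≤ F → x ℕ.* F ≡ y ℕ.* G → ℕq x ≡ ℕq y * ratio G F
  ratio-cross x y G zero x≤0 y≤0 e rewrite ℕP.n≤0⇒n≡0 x≤0 | ℕP.n≤0⇒n≡0 y≤0 = sym (*-zeroˡ (ratio G zero))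
  ratio-cross x y G (suc b) _ _ e = ratio-cross-suc x y G b e

  ≤-mulˡ : {r p q : ℚ} → 0ℚ ≤ r → p ≤ q → r * p ≤ r * q
  ≤-mulˡ {r} r≥0 p≤q = *-monoˡ-≤-nonNeg r {{nonNegative r≥0}} p≤q

  ≤-mulʳ : {r p q : ℚ} → 0ℚ ≤ r → p ≤ q → p * r ≤ q * r
  ≤-mulʳ {r} r≥0 p≤q = *-monoʳ-≤-nonNeg r {{nonNegative r≥0}} p≤q

  0≤* : {p q : ℚ} → 0ℚ ≤ p → 0ℚ ≤ q → 0ℚ ≤ p * q
  0≤* {p} {q} p≥0 q≥0 = subst (_≤ p * q) (*-zeroˡ q) (≤-mulʳ q≥0 p≥0)

  0≤+ : {p q : ℚ} → 0ℚ ≤ p → 0ℚ ≤ q → 0ℚ ≤ p + q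
  0≤+ {p} {q} p≥0 q≥0 = subst (_≤ p + q) (+-identityʳ 0ℚ) (+-mono-≤ p≥0 q≥0)

  x≤x+y : (x y : ℚ) → 0ℚ ≤ y → x ≤ x + y
  x≤x+y x y y≥0 = subst (_≤ x + y) (+-identityʳ x) (+-mono-≤ (≤-refl {x}) y≥0)

  ℕq-*-bound : (x : ℕ) (S B : ℚ) → (0 ℕ.< x → S ≤ B) → ℕq x * S ≤ ℕq x * B
  ℕq-*-bound zero S B h = ≤-reflexive (trans (*-zeroˡ S) (sym (*-zeroˡ B)))
  ℕq-*-bound (suc x) S B h = ≤-mulˡ (ℕq-nonneg (suc x)) (h (s≤s z≤n))

  -- TVD is half the ℓ₁ distance
  halve : (S g : ℚ) → ½ * S ≤ g → S ≤ g + g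
  halve S g h = subst (_≤ g + g) (solve 1 (λ S → con ½ :* S :+ con ½ :* S := S) refl S) (+-mono-≤ h h)
    where open +-*-Solver

  ∣0-x∣ : (x : ℚ) → 0ℚ ≤ x → ∣ 0ℚ - x ∣ ≡ x
  ∣0-x∣ x x≥0 = trans (cong ∣_∣ (+-identityˡ (- x))) (trans (∣-p∣≡∣p∣ x) (0≤p⇒∣p∣≡p x≥0))

  ∣-∣-triangle : (x y z : ℚ) → ∣ x - z ∣ ≤ ∣ x - y ∣ + ∣ y - z ∣
  ∣-∣-triangle x y z = subst (_≤ ∣ x - y ∣ + ∣ y - z ∣) (cong ∣_∣ (solve 3 (λ x y z → (x :- y) :+ (y :- z) := x :- z) refl x y z))
    (∣p+q∣≤∣p∣+∣q∣ (x - y) (y - z))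
    where open +-*-Solver

  ∣-∣-product : (e f p q : ℚ) → 0ℚ ≤ e → 0ℚ ≤ q → ∣ e * p - f * q ∣ ≤ ∣ e - f ∣ * q + e * ∣ p - q ∣
  ∣-∣-product e f p q e≥0 q≥0 = begin
      ∣ e * p - f * q ∣
    ≡⟨ cong ∣_∣ (solve 4 (λ e f p q → e :* p :- f :* q := (e :- f) :* q :+ e :* (p :- q)) refl e f p q) ⟩
      ∣ (e - f) * q + e * (p - q) ∣
    ≤⟨ ∣p+q∣≤∣p∣+∣q∣ ((e - f) * q) (e * (p - q)) ⟩
      ∣ (e - f) * q ∣ + ∣ e * (p - q) ∣
    ≡⟨ cong₂ _+_ (trans (∣p*q∣≡∣p∣*∣q∣ (e - f) q) (cong (∣ e - f ∣ *_) (0≤p⇒∣p∣≡p q≥0)))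
                 (trans (∣p*q∣≡∣p∣*∣q∣ e (p - q)) (cong (_* ∣ p - q ∣) (0≤p⇒∣p∣≡p e≥0))) ⟩
      ∣ e - f ∣ * q + e * ∣ p - q ∣
    ∎
    where
    open ≤-Reasoning
    open +-*-Solver

  ratio-bound : (num den N : ℕ) (g : ℚ) → 0ℚ ≤ g → num ℕ.≤ den → den ℕ.≤ N → ratio num den ≤ g → ℕq num ≤ g * ℕq N
  ratio-bound num zero N g g≥0 num≤0 _ _ rewrite ℕP.n≤0⇒n≡0 num≤0 = 0≤* g≥0 (ℕq-nonneg N)
  ratio-bound num (suc b) N g g≥0 _ den≤N h =
    ≤-trans (subst (_≤ g * ℕq (suc b)) (ratio-cancel num b) (≤-mulʳ (ℕq-nonneg (suc b)) h)) (≤-mulˡ g≥0 (ℕq-mono den≤N))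

  sumℚ-cong : {A : Set} (xs : List A) {f g : A → ℚ} → (∀ x → f x ≡ g x) → sumℚ xs f ≡ sumℚ xs g
  sumℚ-cong [] e = refl
  sumℚ-cong (x ∷ xs) e = cong₂ _+_ (e x) (sumℚ-cong xs e)

  sumℚ-mono : {A : Set} (xs : List A) {f g : A → ℚ} → (∀ x → f x ≤ g x) → sumℚ xs f ≤ sumℚ xs g
  sumℚ-mono [] e = ≤-refl
  sumℚ-mono (x ∷ xs) e = +-mono-≤ (e x) (sumℚ-mono xs e)

  sumℚ-zero : {A : Set} (xs : List A) (f : A → ℚ) → (∀ x → f x ≡ 0ℚ) → sumℚ xs f ≡ 0ℚ
  sumℚ-zero [] f h = refl
  sumℚ-zero (x ∷ xs) f h rewrite h x | sumℚ-zero xs f h = refl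

  sumℚ-+ : {A : Set} (xs : List A) (f g : A → ℚ) → sumℚ xs (λ x → f x + g x) ≡ sumℚ xs f + sumℚ xs g
  sumℚ-+ [] f g = sym (+-identityʳ 0ℚ)
  sumℚ-+ (x ∷ xs) f g rewrite sumℚ-+ xs f g =
    solve 4 (λ a b c d → (a :+ b) :+ (c :+ d) := (a :+ c) :+ (b :+ d)) refl (f x) (g x) (sumℚ xs f) (sumℚ xs g)
    where open +-*-Solver

  sumℚ-+₃ : {A : Set} (xs : List A) (f g h : A → ℚ) → sumℚ xs (λ x → f x + g x + h x) ≡ sumℚ xs f + sumℚ xs g + sumℚ xs h
  sumℚ-+₃ xs f g h = trans (sumℚ-+ xs (λ x → f x + g x) h) (cong (_+ sumℚ xs h) (sumℚ-+ xs f g))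

  sumℚ-*ˡ : {A : Set} (c : ℚ) (xs : List A) (f : A → ℚ) → sumℚ xs (λ x → c * f x) ≡ c * sumℚ xs f
  sumℚ-*ˡ c [] f = sym (*-zeroʳ c)
  sumℚ-*ˡ c (x ∷ xs) f rewrite sumℚ-*ˡ c xs f = sym (*-distribˡ-+ c (f x) (sumℚ xs f))

  sumℚ-ℕq : {A : Set} (xs : List A) (f : A → ℕ) → sumℚ xs (λ x → ℕq (f x)) ≡ ℕq (sumℕ xs f)
  sumℚ-ℕq [] f = refl
  sumℚ-ℕq (x ∷ xs) f rewrite sumℚ-ℕq xs f = sym (ℕq-+ (f x) (sumℕ xs f))

  sumℚ-++ : {A : Set} (xs ys : List A) (f : A → ℚ) → sumℚ (xs ++ ys) f ≡ sumℚ xs f + sumℚ ys f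
  sumℚ-++ [] ys f = sym (+-identityˡ _)
  sumℚ-++ (x ∷ xs) ys f rewrite sumℚ-++ xs ys f = sym (+-assoc (f x) _ _)

  sumℚ-map : {A B : Set} (g : A → B) (xs : List A) (f : B → ℚ) → sumℚ (L.map g xs) f ≡ sumℚ xs (λ x → f (g x))
  sumℚ-map g [] f = refl
  sumℚ-map g (x ∷ xs) f = cong (λ rest → f (g x) + rest) (sumℚ-map g xs f)

  sumℚ-× : {A B : Set} (xs : List A) (ys : List B) (f : A × B → ℚ) →
    sumℚ (cartesianProduct xs ys) f ≡ sumℚ xs (λ x → sumℚ ys (λ y → f (x , y)))
  sumℚ-× [] ys f = refl
  sumℚ-× (x ∷ xs) ys f = trans (sumℚ-++ (L.map (x ,_) ys) _ f) (cong₂ _+_ (sumℚ-map (x ,_) ys f) (sumℚ-× xs ys f))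

  sumℚ-allVecs-suc : {A : Set} (xs : List A) (j : ℕ) (h : Vec A (suc j) → ℚ) →
    sumℚ (allVecs xs (suc j)) h ≡ sumℚ xs (λ x → sumℚ (allVecs xs j) (λ w → h (x ∷ w)))
  sumℚ-allVecs-suc xs j h = trans (sumℚ-map _ (cartesianProduct xs (allVecs xs j)) h) (sumℚ-× xs (allVecs xs j) _)

  sumℚ-allVecs-∷ʳ : {A : Set} (xs : List A) (j : ℕ) (h : Vec A (suc j) → ℚ) →
    sumℚ (allVecs xs (suc j)) h ≡ sumℚ (allVecs xs j) (λ s → sumℚ xs (λ σ → h (s ∷ʳ σ)))
  sumℚ-allVecs-∷ʳ xs zero h =
    trans (sumℚ-allVecs-suc xs zero h) (trans (sumℚ-cong xs (λ x → +-identityʳ (h (x ∷ [])))) (sym (+-identityʳ _)))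
  sumℚ-allVecs-∷ʳ xs (suc j) h =
    trans (sumℚ-allVecs-suc xs (suc j) h)
    (trans (sumℚ-cong xs (λ x → sumℚ-allVecs-∷ʳ xs j (λ w → h (x ∷ w))))
           (sym (sumℚ-allVecs-suc xs j (λ s′ → sumℚ xs (λ σ → h (s′ ∷ʳ σ))))))

  sum-ratio≤1 : {X : Set} (xs : List X) (cs : X → ℕ) (N : ℕ) → IsSuc N → sumℕ xs cs ℕ.≤ N →
    sumℚ xs (λ x → ratio (cs x) N) ≤ 1ℚ
  sum-ratio≤1 xs cs .(suc b) (b , refl) total≤N = begin
      sumℚ xs (λ x → ratio (cs x) (suc b))
    ≡⟨ sumℚ-cong xs (λ x → trans (ratio-scale (cs x) b) (*-comm (ℕq (cs x)) w)) ⟩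
      sumℚ xs (λ x → w * ℕq (cs x))
    ≡⟨ trans (sumℚ-*ˡ w xs (λ x → ℕq (cs x))) (cong (w *_) (sumℚ-ℕq xs cs)) ⟩
      w * ℕq (sumℕ xs cs)
    ≤⟨ ≤-mulˡ (ratio-nonneg 1 (suc b)) (ℕq-mono total≤N) ⟩
      w * ℕq (suc b)
    ≡⟨ ratio-cancel 1 b ⟩
      1ℚ
    ∎
    where
    open ≤-Reasoning
    w : ℚ
    w = ratio 1 (suc b)

  ratio-inverse : (N : ℕ) → IsSuc N → ratio 1 N * ℕq N ≡ 1ℚ
  ratio-inverse .(suc b) (b , refl) = ratio-cancel 1 b

  ∣ratio-ratio∣ : (a c N : ℕ) → IsSuc N → ∣ ratio a N - ratio c N ∣ ≡ ratio 1 N * ∣ ℕq a - ℕq c ∣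
  ∣ratio-ratio∣ a c .(suc b) (b , refl) = begin
      ∣ ratio a (suc b) - ratio c (suc b) ∣
    ≡⟨ cong₂ (λ x y → ∣ x - y ∣) (ratio-scale a b) (ratio-scale c b) ⟩
      ∣ ℕq a * w - ℕq c * w ∣
    ≡⟨ cong ∣_∣ (solve 3 (λ a c w → a :* w :- c :* w := (a :- c) :* w) refl (ℕq a) (ℕq c) w) ⟩
      ∣ (ℕq a - ℕq c) * w ∣
    ≡⟨ trans (∣p*q∣≡∣p∣*∣q∣ (ℕq a - ℕq c) w) (cong (∣ ℕq a - ℕq c ∣ *_) (0≤p⇒∣p∣≡p (ratio-nonneg 1 (suc b)))) ⟩
      ∣ ℕq a - ℕq c ∣ * w
    ≡⟨ *-comm ∣ ℕq a - ℕq c ∣ w ⟩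
      w * ∣ ℕq a - ℕq c ∣
    ∎
    where
    open ≡-Reasoning
    open +-*-Solver
    w : ℚ
    w = ratio 1 (suc b)


module ChainRule where

  -- Appending a state σ multiplies these counts by the one-step transition
  -- probabilities:
  --   YES:  countY (j+1) M (s σ) = countY j M s · Pr[S^Y_{j+1} = σ | M_{1:j+1}, S^Y_{1:j} = s]
  --   NO:   countN (j+1) M (s σ) = countN j M s · Pr_U[r_{j+1}(M_{1:j+1}, s, U) = σ].
  -- Both follow from the product structure of Ω = {0,1}^n × ({0,1}^m)^T × matchings^T:
  -- the YES states depend only on (X*, M), the NO states only on (U, M), and the
  -- NO input of round j+1 is a coordinate of U on which nothing earlier depends.

  open import Data.Bool using (Bool; true; false; _∧_)
  open import Data.Nat using (ℕ; suc; _*_; _≤_)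
  open import Data.Nat.Properties
  open import Data.Nat.Solver using (module +-*-Solver)
  open import Data.Fin using (Fin; toℕ; fromℕ<)
  open import Data.Fin.Properties using (toℕ<n; toℕ-fromℕ<) renaming (_≟_ to _≟F_)
  open import Data.Product using (_,_)
  open import Data.List using (List; length)
  open import Data.Vec as V using (Vec; lookup; _∷ʳ_; _[_]≔_)
  import Data.Vec.Properties as VP
  open import Relation.Binary.PropositionalEquality
  open import Relation.Nullary.Decidable using (⌊_⌋)
  open import Defs
  open Counting
  open BooleanEvents
  open Runs

  module _ {n m k T : ℕ} (r : Rounds n m k T) where

    Ulist : List (Vec (Bits m) T)
    Ulist = allVecs (allBits m) T

    Mlist : List (Vec (Matching n m) T)
    Mlist = allVecs (allMatchings n m) T

    sumΩ : (g : Ω n m T → ℕ) → sumℕ (allΩ n m T) g ≡ sumℕ (allBits n) (λ x → sumℕ Ulist (λ u → sumℕ Mlist (λ M′ → g (x , u , M′))))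
    sumΩ g = trans (sumℕ-× (allBits n) _ g) (sumℕ-cong (allBits n) (λ x → sumℕ-× Ulist Mlist _))

    count-product : (P : Ω n m T → Bool) (Q : Vec (Matching n m) T → Bool) (f : Bits n → Vec (Bits m) T → Bool) →
      (∀ x u M′ → 𝟙 (P (x , u , M′)) ≡ 𝟙 (Q M′) * 𝟙 (f x u)) →
      countᵇ P (allΩ n m T) ≡ countᵇ Q Mlist * sumℕ (allBits n) (λ x → sumℕ Ulist (λ u → 𝟙 (f x u)))
    count-product P Q f split = begin
        countᵇ P (allΩ n m T)
      ≡⟨ trans (count≡sum P (allΩ n m T)) (sumΩ _) ⟩
        sumℕ (allBits n) (λ x → sumℕ Ulist (λ u → sumℕ Mlist (λ M′ → 𝟙 (P (x , u , M′)))))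
      ≡⟨ sumℕ-cong (allBits n) (λ x → sumℕ-cong Ulist (λ u →
           trans (sumℕ-cong Mlist (split x u)) (trans (sumℕ-*ʳ Mlist (λ M′ → 𝟙 (Q M′)) (𝟙 (f x u))) (cong (_* 𝟙 (f x u)) (sym (count≡sum Q Mlist)))))) ⟩
        sumℕ (allBits n) (λ x → sumℕ Ulist (λ u → countᵇ Q Mlist * 𝟙 (f x u)))
      ≡⟨ trans (sumℕ-cong (allBits n) (λ x → sumℕ-*ˡ (countᵇ Q Mlist) Ulist _)) (sumℕ-*ˡ (countᵇ Q Mlist) (allBits n) _) ⟩
        countᵇ Q Mlist * sumℕ (allBits n) (λ x → sumℕ Ulist (λ u → 𝟙 (f x u)))
      ∎
      where open ≡-Reasoning

    countY : (j : ℕ) → j ≤ T → Vec (Matching n m) T → Vec (Fin k) j → ℕ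
    countY j q M s = countᵇ (λ ω → eqMatchings (Mof ω) M ∧ eqStates (SY r ω j q) s) (allΩ n m T)

    countN : (j : ℕ) → j ≤ T → Vec (Matching n m) T → Vec (Fin k) j → ℕ
    countN j q M s = countᵇ (λ ω → eqMatchings (Mof ω) M ∧ eqStates (SN r ω j q) s) (allΩ n m T)

    module Step (j : ℕ) (p : suc j ≤ T) (q : j ≤ T) (M : Vec (Matching n m) T) (s : Vec (Fin k) j) (σ : Fin k) where
      i : Fin T
      i = fromℕ< p
      ti : toℕ i ≡ j
      ti = toℕ-fromℕ< p
      Mp : Vec (Matching n m) (suc (toℕ i))
      Mp = prefix M (suc (toℕ i)) (toℕ<n i)
      sh : Vec (Fin k) (toℕ i)
      sh = V.cast (sym ti) s

      pastY nextY : Bits n → Vec (Bits m) T → Bool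
      pastY x u = eqStates (run r M (inputsY r x M) j q) s
      nextY x u = pastY x u ∧ ⌊ runStep r M (inputsY r x M) j p ≟F σ ⌋

      samePrefix : Vec (Matching n m) T → Bool
      samePrefix M′ = eqMatchings (prefix M′ (suc (toℕ i)) (toℕ<n i)) Mp

      samePrefix-agree : (M′ : Vec (Matching n m) T) → samePrefix M′ ≡ true → Agree M′ M (suc j)
      samePrefix-agree M′ e = Agree-≤ M′ M (≤-reflexive (cong suc (sym ti))) (agree-prefix M′ M _ _ (eqMatchings-sound e))

      historyY : (x : Bits n) (u : Vec (Bits m) T) (M′ : Vec (Matching n m) T) → samePrefix M′ ≡ true →
        eqStates (SYhist r (x , u , M′) i) sh ≡ pastY x u
      historyY x u M′ e =
        trans (cong (λ z → eqStates z sh) (family-cast (λ a qa → run r M′ (inputsY r x M′) a qa) (run-irrelevant r M′ (inputsY r x M′)) (sym ti) q _))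
        (trans (eqStates-cast (sym ti) (run r M′ (inputsY r x M′) j q) s)
          (cong (λ z → eqStates z s) (run-local r M′ M (inputsY r x M′) (inputsY r x M) j q agree (inputsY-agree r x M′ M j agree))))
        where
        agree : Agree M′ M j
        agree = Agree-≤ M′ M (n≤1+n j) (samePrefix-agree M′ e)

      stateY : (x : Bits n) (u : Vec (Bits m) T) (M′ : Vec (Matching n m) T) → samePrefix M′ ≡ true →
        SYat r (x , u , M′) i ≡ runStep r M (inputsY r x M) j p
      stateY x u M′ e = trans (lookup-run r M′ (inputsY r x M′) T ≤-refl i)
        (trans (index-irrelevant (runStep r M′ (inputsY r x M′)) ti _ p)
          (VP.∷ʳ-injectiveʳ _ _ (trans (sym (run-∷ʳ r M′ (inputsY r x M′) j p q))
             (trans (run-local r M′ M (inputsY r x M′) (inputsY r x M) (suc j) p agree (inputsY-agree r x M′ M (suc j) agree))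
               (run-∷ʳ r M (inputsY r x M) j p q)))))
        where
        agree : Agree M′ M (suc j)
        agree = samePrefix-agree M′ e

      F G A B : ℕ
      F = countᵇ (fixedHist r i Mp sh) (allΩ n m T)
      G = countᵇ (λ ω → ⌊ SYat r ω i ≟F σ ⌋ ∧ fixedHist r i Mp sh ω) (allΩ n m T)
      A = sumℕ (allBits n) (λ x → sumℕ Ulist (λ u → 𝟙 (nextY x u)))
      B = sumℕ (allBits n) (λ x → sumℕ Ulist (λ u → 𝟙 (pastY x u)))

      countY-next : countY (suc j) p M (s ∷ʳ σ) ≡ countᵇ (λ M′ → eqMatchings M′ M) Mlist * A
      countY-next = count-product _ (λ M′ → eqMatchings M′ M) nextY λ x u M′ →
        trans (𝟙-∧-≟ _≟M_ M′ M (λ N → eqStates (run r N (inputsY r x N) (suc j) p) (s ∷ʳ σ)))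
          (cong (λ z → 𝟙 (eqMatchings M′ M) * 𝟙 z)
            (trans (cong (λ z → eqStates z (s ∷ʳ σ)) (run-∷ʳ r M (inputsY r x M) j p q)) (eqStates-∷ʳ _ s _ σ)))

      countY-past : countY j q M s ≡ countᵇ (λ M′ → eqMatchings M′ M) Mlist * B
      countY-past = count-product _ (λ M′ → eqMatchings M′ M) pastY λ x u M′ →
        𝟙-∧-≟ _≟M_ M′ M (λ N → eqStates (run r N (inputsY r x N) j q) s)

      F-product : F ≡ countᵇ samePrefix Mlist * B
      F-product = count-product (fixedHist r i Mp sh) samePrefix pastY λ x u M′ →
        𝟙-∧-guarded (samePrefix M′) _ (pastY x u) (historyY x u M′)

      G-product : G ≡ countᵇ samePrefix Mlist * A
      G-product = count-product _ samePrefix nextY λ x u M′ →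
        trans (cong 𝟙 (∧-rotate ⌊ SYat r (x , u , M′) i ≟F σ ⌋ (samePrefix M′) (eqStates (SYhist r (x , u , M′) i) sh)))
          (𝟙-∧-guarded (samePrefix M′) _ (nextY x u)
            (λ e → cong₂ _∧_ (historyY x u M′ e) (cong (λ z → ⌊ z ≟F σ ⌋) (stateY x u M′ e))))

      chainY : countY (suc j) p M (s ∷ʳ σ) * F ≡ countY j q M s * G
      chainY rewrite countY-next | countY-past | F-product | G-product =
        solve 4 (λ a b c d → (a :* c) :* (b :* d) := (a :* d) :* (b :* c)) refl
          (countᵇ (λ M′ → eqMatchings M′ M) Mlist) (countᵇ samePrefix Mlist) A B
        where open +-*-Solver

      toσ : Bits m → Bool
      toσ w = ⌊ r i Mp sh w ≟F σ ⌋

      pastN : Vec (Bits m) T → ℕ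
      pastN u = sumℕ Mlist (λ M′ → 𝟙 (eqMatchings M′ M ∧ eqStates (run r M′ u j q) s))

      pastN-fresh : (u : Vec (Bits m) T) (w : Bits m) → pastN (u [ i ]≔ w) ≡ pastN u
      pastN-fresh u w = sumℕ-cong Mlist (λ M′ → cong (λ z → 𝟙 (eqMatchings M′ M ∧ eqStates z s))
        (run-local r M′ M′ (u [ i ]≔ w) u j q (λ _ _ → refl)
          (λ idx lt → VP.lookup∘update′ (λ e → <-irrefl (trans (cong toℕ e) ti) lt) u w)))

      indicatorN-next : (x : Bits n) (u : Vec (Bits m) T) (M′ : Vec (Matching n m) T) →
        𝟙 (eqMatchings M′ M ∧ eqStates (SN r (x , u , M′) (suc j) p) (s ∷ʳ σ))
          ≡ 𝟙 (toσ (lookup u i)) * 𝟙 (eqMatchings M′ M ∧ eqStates (run r M′ u j q) s)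
      indicatorN-next x u M′ =
        trans (cong (λ z → 𝟙 (eqMatchings M′ M ∧ z))
                 (trans (cong (λ z → eqStates z (s ∷ʳ σ)) (run-∷ʳ r M′ u j p q)) (eqStates-∷ʳ _ s _ σ)))
        (trans (cong 𝟙 (∧-assoc-guarded (eqMatchings M′ M) (eqStates (run r M′ u j q) s) _ (toσ (lookup u i))
                  (λ e₁ e₂ → cong (λ z → ⌊ z ≟F σ ⌋) (runStep-at r M′ M u j p q s (eqMatchings-sound e₁) (eqStates-sound e₂)))))
          (𝟙-∧-comm (eqMatchings M′ M ∧ eqStates (run r M′ u j q) s) (toσ (lookup u i))))
        where
        ∧-assoc-guarded : (a b c c′ : Bool) → (a ≡ true → b ≡ true → c ≡ c′) → (a ∧ (b ∧ c)) ≡ ((a ∧ b) ∧ c′)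
        ∧-assoc-guarded false b c c′ f = refl
        ∧-assoc-guarded true false c c′ f = refl
        ∧-assoc-guarded true true c c′ f = f refl refl

      chainN : countN (suc j) p M (s ∷ʳ σ) * length (allBits m) ≡ countN j q M s * countᵇ toσ (allBits m)
      chainN = begin
          countN (suc j) p M (s ∷ʳ σ) * L
        ≡⟨ cong (_* L) (trans (count≡sum _ (allΩ n m T)) (trans (sumΩ _)
             (sumℕ-cong (allBits n) (λ x → sumℕ-cong Ulist (λ u →
                trans (sumℕ-cong Mlist (indicatorN-next x u)) (sumℕ-*ˡ (𝟙 (toσ (lookup u i))) Mlist _)))))) ⟩
          sumℕ (allBits n) (λ x → sumℕ Ulist (λ u → 𝟙 (toσ (lookup u i)) * pastN u)) * L
        ≡⟨ sym (sumℕ-*ʳ (allBits n) _ L) ⟩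
          sumℕ (allBits n) (λ x → sumℕ Ulist (λ u → 𝟙 (toσ (lookup u i)) * pastN u) * L)
        ≡⟨ sumℕ-cong (allBits n) (λ x → coordinate-independence (allBits m) T i toσ pastN pastN-fresh) ⟩
          sumℕ (allBits n) (λ x → sumℕ Ulist pastN * countᵇ toσ (allBits m))
        ≡⟨ sumℕ-*ʳ (allBits n) _ _ ⟩
          sumℕ (allBits n) (λ x → sumℕ Ulist pastN) * countᵇ toσ (allBits m)
        ≡⟨ cong (_* countᵇ toσ (allBits m)) (sym (trans (count≡sum _ (allΩ n m T)) (sumΩ _))) ⟩
          countN j q M s * countᵇ toσ (allBits m)
        ∎
        where
        open ≡-Reasoning
        L : ℕ
        L = length (allBits m)


module TotalProbability where

  -- Classifying the
  -- sample points ω by the pair (fM ω, fS ω) over repetition-free lists of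
  -- candidate values, each ω is counted at most once, so for any event B on pairs
  --   Σ_M Σ_s [B M s] · #{ω | fM ω = M, fS ω = s}  ≤  #{ω | B (fM ω) (fS ω)}.

  open import Data.Bool using (Bool; _∧_)
  open import Data.Nat using (_*_; _≤_)
  open import Data.Nat.Properties
  open import Data.List using (List)
  open import Data.List.Relation.Unary.Unique.Propositional using (Unique)
  open import Relation.Binary.Definitions using (DecidableEquality)
  open import Relation.Binary.PropositionalEquality
  open import Relation.Nullary using (yes; no)
  open import Relation.Nullary.Decidable using (⌊_⌋)
  open import Defs using (countᵇ)
  open Counting

  module _ {Ω′ M′ S′ : Set} (Ωl : List Ω′) (Ml : List M′) (Sl : List S′)
           (_≟M_ : DecidableEquality M′) (_≟S_ : DecidableEquality S′)
           (uniqueM : Unique Ml) (uniqueS : Unique Sl) (fM : Ω′ → M′) (fS : Ω′ → S′) where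

    cell-indicator : (B : M′ → S′ → Bool) (a : M′) (b : S′) (M : M′) (s : S′) →
      𝟙 (B M s) * 𝟙 (⌊ a ≟M M ⌋ ∧ ⌊ b ≟S s ⌋) ≡ 𝟙 ⌊ a ≟M M ⌋ * (𝟙 ⌊ b ≟S s ⌋ * 𝟙 (B a b))
    cell-indicator B a b M s with a ≟M M | b ≟S s
    ... | yes refl | yes refl = trans (*-comm (𝟙 (B a b)) 1) (sym (+-identityʳ _))
    ... | yes refl | no _ = *-zeroʳ (𝟙 (B a s))
    ... | no _ | yes _ = *-zeroʳ (𝟙 (B M s))
    ... | no _ | no _ = *-zeroʳ (𝟙 (B M s))

    one-cell : (B : M′ → S′ → Bool) (ω : Ω′) →
      sumℕ Ml (λ M → sumℕ Sl (λ s → 𝟙 (B M s) * 𝟙 (⌊ fM ω ≟M M ⌋ ∧ ⌊ fS ω ≟S s ⌋))) ≤ 𝟙 (B (fM ω) (fS ω))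
    one-cell B ω = begin
        sumℕ Ml (λ M → sumℕ Sl (λ s → 𝟙 (B M s) * 𝟙 (⌊ a ≟M M ⌋ ∧ ⌊ b ≟S s ⌋)))
      ≡⟨ sumℕ-cong Ml (λ M → trans (sumℕ-cong Sl (cell-indicator B a b M)) (sumℕ-*ˡ (𝟙 ⌊ a ≟M M ⌋) Sl _)) ⟩
        sumℕ Ml (λ M → 𝟙 ⌊ a ≟M M ⌋ * sumℕ Sl (λ s → 𝟙 ⌊ b ≟S s ⌋ * 𝟙 (B a b)))
      ≡⟨ trans (sumℕ-*ʳ Ml _ _) (cong₂ _*_ (sym (count≡sum (λ M → ⌊ a ≟M M ⌋) Ml))
                                          (trans (sumℕ-*ʳ Sl _ _) (cong (_* 𝟙 (B a b)) (sym (count≡sum (λ s → ⌊ b ≟S s ⌋) Sl))))) ⟩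
        countᵇ (λ M → ⌊ a ≟M M ⌋) Ml * (countᵇ (λ s → ⌊ b ≟S s ⌋) Sl * 𝟙 (B a b))
      ≤⟨ *-mono-≤ (count-≡-unique _≟M_ a Ml uniqueM) (*-mono-≤ (count-≡-unique _≟S_ b Sl uniqueS) (≤-refl {𝟙 (B a b)})) ⟩
        1 * (1 * 𝟙 (B a b))
      ≡⟨ trans (*-identityˡ _) (*-identityˡ _) ⟩
        𝟙 (B a b)
      ∎
      where
      open ≤-Reasoning
      a : M′
      a = fM ω
      b : S′
      b = fS ω

    total-probability : (B : M′ → S′ → Bool) →
      sumℕ Ml (λ M → sumℕ Sl (λ s → 𝟙 (B M s) * countᵇ (λ ω → ⌊ fM ω ≟M M ⌋ ∧ ⌊ fS ω ≟S s ⌋) Ωl))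
        ≤ countᵇ (λ ω → B (fM ω) (fS ω)) Ωl
    total-probability B = begin
        sumℕ Ml (λ M → sumℕ Sl (λ s → 𝟙 (B M s) * countᵇ (cell M s) Ωl))
      ≡⟨ sumℕ-cong Ml (λ M → sumℕ-cong Sl (λ s → trans (cong (𝟙 (B M s) *_) (count≡sum _ Ωl)) (sym (sumℕ-*ˡ (𝟙 (B M s)) Ωl _)))) ⟩
        sumℕ Ml (λ M → sumℕ Sl (λ s → sumℕ Ωl (λ ω → 𝟙 (B M s) * 𝟙 (cell M s ω))))
      ≡⟨ trans (sumℕ-cong Ml (λ M → sumℕ-swap Sl Ωl _)) (sumℕ-swap Ml Ωl _) ⟩
        sumℕ Ωl (λ ω → sumℕ Ml (λ M → sumℕ Sl (λ s → 𝟙 (B M s) * 𝟙 (cell M s ω))))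
      ≤⟨ sumℕ-mono Ωl (one-cell B) ⟩
        sumℕ Ωl (λ ω → 𝟙 (B (fM ω) (fS ω)))
      ≡⟨ sym (count≡sum _ Ωl) ⟩
        countᵇ (λ ω → B (fM ω) (fS ω)) Ωl
      ∎
      where
      open ≤-Reasoning
      cell : M′ → S′ → Ω′ → Bool
      cell M s ω = ⌊ fM ω ≟M M ⌋ ∧ ⌊ fS ω ≟S s ⌋


module HybridProcess where

  -- The hybrid count  countŶ j M s = [good j M s] · countY j M s
  -- is the YES process killed as soon as it leaves the good events.  Through one
  -- round the distance to the NO process grows by at most
  --   2g · countY(s)          (the conditional TVD bound on a good history)
  --   + [good ∧ ¬𝓔_{j+1}] · countY(s)   (mass that leaves the good events).

  open import Data.Bool using (Bool; true; false; not; _∧_)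
  open import Data.Nat as ℕ using (ℕ; zero; suc; _≤_; _<_)
  import Data.Nat.Properties as ℕP
  open import Data.Fin using (Fin; toℕ; fromℕ<)
  open import Data.Fin.Properties using (toℕ<n; toℕ-fromℕ<) renaming (_≟_ to _≟F_)
  open import Data.Product using (Σ; _,_)
  open import Data.List using (List; _∷_; length; allFin)
  import Data.List.Relation.Unary.Unique.Propositional.Properties as Unique
  open import Data.Rational using (ℚ; 0ℚ; 1ℚ; _+_; _*_; _-_; ∣_∣) renaming (_≤_ to _≤q_)
  open import Data.Rational.Properties using (≤-refl; ≤-trans; +-mono-≤; +-identityʳ; +-comm; *-identityʳ; *-comm; 0≤∣p∣; module ≤-Reasoning)
  open import Data.Vec as V using (Vec; _∷ʳ_)
  import Data.Vec.Properties as VP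
  open import Relation.Binary.PropositionalEquality
  open import Relation.Nullary.Decidable using (⌊_⌋)
  open import Defs
  open Counting
  open BooleanEvents
  open Runs
  open Rationals
  open ChainRule

  allBits-cons : (j : ℕ) → Σ (Bits j) (λ v → Σ (List (Bits j)) (λ vs → allBits j ≡ v ∷ vs))
  allBits-cons zero = _ , _ , refl
  allBits-cons (suc j) with allBits-cons j
  ... | v , vs , e rewrite e = _ , _ , refl

  allBits-nonempty : (j : ℕ) → IsSuc (length (allBits j))
  allBits-nonempty j with allBits-cons j
  ... | v , vs , e = length vs , cong length e

  module _ {n m k T : ℕ} (r : Rounds n m k T) (E : Events n m k T) where

    nextEvent : (j : ℕ) → suc j ≤ T → Vec (Matching n m) T → Vec (Fin k) j → Bool
    nextEvent j p M s = E (fromℕ< p) (prefix M (suc (toℕ (fromℕ< p))) (toℕ<n (fromℕ< p))) (V.cast (sym (toℕ-fromℕ< p)) s)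

    good : (j : ℕ) → j ≤ T → Vec (Matching n m) T → Vec (Fin k) j → Bool
    good zero q M s = true
    good (suc j) p M s = good j (ℕP.≤-trans (ℕP.n≤1+n j) p) M (V.init s) ∧ nextEvent j p M (V.init s)

    good-irrelevant : (j : ℕ) (q q′ : j ≤ T) (M : Vec (Matching n m) T) (s : Vec (Fin k) j) → good j q M s ≡ good j q′ M s
    good-irrelevant j q q′ M s rewrite ℕP.≤-irrelevant q q′ = refl

    good-∷ʳ : (j : ℕ) (p : suc j ≤ T) (q : j ≤ T) (M : Vec (Matching n m) T) (s : Vec (Fin k) j) (σ : Fin k) →
      good (suc j) p M (s ∷ʳ σ) ≡ (good j q M s ∧ nextEvent j p M s)
    good-∷ʳ j p q M s σ rewrite VP.init-∷ʳ σ s = cong (_∧ nextEvent j p M s) (good-irrelevant j _ q M s)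

    countŶ : (j : ℕ) → j ≤ T → Vec (Matching n m) T → Vec (Fin k) j → ℕ
    countŶ j q M s = 𝟙 (good j q M s) ℕ.* countY r j q M s

    badStep : (j : ℕ) → suc j ≤ T → j ≤ T → Vec (Matching n m) T → Vec (Fin k) j → Bool
    badStep j p q M s = good j q M s ∧ not (nextEvent j p M s)

    module _ (g : ℚ) (g≥0 : 0ℚ ≤q g)
             (step-tvd : (i : Fin T) (Mh : Vec (Matching n m) (suc (toℕ i))) (sh : Vec (Fin k) (toℕ i)) →
                E i Mh sh ≡ true → 0 < countᵇ (fixedHist r i Mh sh) (allΩ n m T) →
                tvd (allFin k) (condDistY r i Mh sh) (distN r i Mh sh) ≤q g) where

      module OneRound (j : ℕ) (p : suc j ≤ T) (q : j ≤ T) (M : Vec (Matching n m) T) (s : Vec (Fin k) j) where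
        i : Fin T
        i = fromℕ< p
        Mp : Vec (Matching n m) (suc (toℕ i))
        Mp = prefix M (suc (toℕ i)) (toℕ<n i)
        sh : Vec (Fin k) (toℕ i)
        sh = V.cast (sym (toℕ-fromℕ< p)) s
        Ωl : List (Ω n m T)
        Ωl = allΩ n m T

        pY pN : Fin k → ℚ
        pY σ = condDistY r i Mp sh σ
        pN σ = distN r i Mp sh σ

        cY cN : ℕ
        cY = countY r j q M s
        cN = countN r j q M s

        cY≤conditioning : cY ≤ countᵇ (fixedHist r i Mp sh) Ωl
        cY≤conditioning = count-mono _ (fixedHist r i Mp sh) Ωl λ ω h →
          ∧-intro (eqMatchings-complete (cong (λ z → prefix z (suc (toℕ i)) (toℕ<n i)) (eqMatchings-sound (∧-elimˡ _ _ h))))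
                  (eqStates-complete (trans (family-cast (SY r ω) (λ a qa qa′ → run-irrelevant r (Mof ω) _ a qa qa′) (sym (toℕ-fromℕ< p)) q _)
                                            (cong (V.cast (sym (toℕ-fromℕ< p))) (eqStates-sound (∧-elimʳ _ _ h)))))

        countY-∷ʳ≤ : (σ : Fin k) → countY r (suc j) p M (s ∷ʳ σ) ≤ cY
        countY-∷ʳ≤ σ = count-mono _ _ Ωl λ ω h →
          ∧-intro (∧-elimˡ _ _ h) (eqStates-complete (VP.∷ʳ-injectiveˡ _ _ (trans (sym (run-∷ʳ r (Mof ω) _ j p q)) (eqStates-sound (∧-elimʳ _ _ h)))))

        chainY-ℚ : (σ : Fin k) → ℕq (countY r (suc j) p M (s ∷ʳ σ)) ≡ ℕq cY * pY σ
        chainY-ℚ σ = ratio-cross _ cY _ _ (ℕP.≤-trans (countY-∷ʳ≤ σ) cY≤conditioning) cY≤conditioning (Step.chainY r j p q M s σ)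

        chainN-ℚ : (σ : Fin k) → ℕq (countN r (suc j) p M (s ∷ʳ σ)) ≡ ℕq cN * pN σ
        chainN-ℚ σ = ratio-cross-pos (countN r (suc j) p M (s ∷ʳ σ)) cN (countᵇ (Step.toσ r j p q M s σ) (allBits m)) (length (allBits m))
                       (allBits-nonempty m) (Step.chainN r j p q M s σ)

        pN≥0 : (σ : Fin k) → 0ℚ ≤q pN σ
        pN≥0 σ = ratio-nonneg (countᵇ (Step.toσ r j p q M s σ) (allBits m)) (length (allBits m))

        -- the NO kernel has total mass at most one: each input leads to one state
        pN-total : sumℚ (allFin k) pN ≤q 1ℚ
        pN-total = sum-ratio≤1 (allFin k) (λ σ → countᵇ (Step.toσ r j p q M s σ) (allBits m)) (length (allBits m)) (allBits-nonempty m) (begin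
            sumℕ (allFin k) (λ σ → countᵇ (λ w → ⌊ r i Mp sh w ≟F σ ⌋) (allBits m))
          ≡⟨ trans (sumℕ-cong (allFin k) (λ σ → count≡sum _ (allBits m))) (sumℕ-swap (allFin k) (allBits m) (λ σ w → 𝟙 ⌊ r i Mp sh w ≟F σ ⌋)) ⟩
            sumℕ (allBits m) (λ w → sumℕ (allFin k) (λ σ → 𝟙 ⌊ r i Mp sh w ≟F σ ⌋))
          ≤⟨ sumℕ-mono (allBits m) (λ w → ℕP.≤-trans (ℕP.≤-reflexive (sym (count≡sum _ (allFin k))))
                                                      (count-≡-unique _≟F_ (r i Mp sh w) (allFin k) (Unique.allFin⁺ k))) ⟩
            sumℕ (allBits m) (λ _ → 1)
          ≡⟨ trans (sumℕ-const (allBits m) 1) (ℕP.*-identityʳ _) ⟩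
            length (allBits m)
          ∎)
          where open ℕP.≤-Reasoning

        kernels-close : nextEvent j p M s ≡ true → 0 < cY → sumℚ (allFin k) (λ σ → ∣ pY σ - pN σ ∣) ≤q g + g
        kernels-close e cY>0 = halve _ g (step-tvd i Mp sh e (ℕP.<-≤-trans cY>0 cY≤conditioning))

        distance′ : Fin k → ℚ
        distance′ σ = ∣ ℕq (countŶ (suc j) p M (s ∷ʳ σ)) - ℕq (countN r (suc j) p M (s ∷ʳ σ)) ∣

        budget : Bool → Bool → ℚ
        budget b₁ b₂ = ∣ ℕq (𝟙 b₁ ℕ.* cY) - ℕq cN ∣ + (g + g) * ℕq cY + ℕq (𝟙 (b₁ ∧ not b₂) ℕ.* cY)

        -- if the hybrid is killed in this round, only the NO mass remains
        killed : (good j q M s ∧ nextEvent j p M s) ≡ false → sumℚ (allFin k) distance′ ≤q ℕq cN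
        killed h = begin
            sumℚ (allFin k) distance′
          ≡⟨ sumℚ-cong (allFin k) only-NO ⟩
            sumℚ (allFin k) (λ σ → ℕq cN * pN σ)
          ≡⟨ sumℚ-*ˡ (ℕq cN) (allFin k) pN ⟩
            ℕq cN * sumℚ (allFin k) pN
          ≤⟨ ≤-mulˡ (ℕq-nonneg cN) pN-total ⟩
            ℕq cN * 1ℚ
          ≡⟨ *-identityʳ (ℕq cN) ⟩
            ℕq cN
          ∎
          where
          open ≤-Reasoning
          only-NO : (σ : Fin k) → distance′ σ ≡ ℕq cN * pN σ
          only-NO σ = trans (cong (λ b → ∣ ℕq (𝟙 b ℕ.* countY r (suc j) p M (s ∷ʳ σ)) - ℕq (countN r (suc j) p M (s ∷ʳ σ)) ∣)
                                  (trans (good-∷ʳ j p q M s σ) h))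
                            (trans (cong (λ z → ∣ 0ℚ - z ∣) (chainN-ℚ σ)) (∣0-x∣ _ (0≤* (ℕq-nonneg cN) (pN≥0 σ))))

        NO-mass≤budget : (b₁ b₂ : Bool) → (b₁ ∧ b₂) ≡ false → ℕq cN ≤q budget b₁ b₂
        NO-mass≤budget b₁ b₂ h = begin
            ℕq cN
          ≤⟨ NO-mass≤ b₁ b₂ h ⟩
            distance + escaping
          ≤⟨ +-mono-≤ (x≤x+y distance ((g + g) * ℕq cY) (0≤* (0≤+ g≥0 g≥0) (ℕq-nonneg cY))) (≤-refl {escaping}) ⟩
            budget b₁ b₂
          ∎
          where
          open ≤-Reasoning
          distance escaping : ℚ
          distance = ∣ ℕq (𝟙 b₁ ℕ.* cY) - ℕq cN ∣
          escaping = ℕq (𝟙 (b₁ ∧ not b₂) ℕ.* cY)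
          NO-mass≤ : (b₁ b₂ : Bool) → (b₁ ∧ b₂) ≡ false → ℕq cN ≤q ∣ ℕq (𝟙 b₁ ℕ.* cY) - ℕq cN ∣ + ℕq (𝟙 (b₁ ∧ not b₂) ℕ.* cY)
          NO-mass≤ false b₂ _ = begin
              ℕq cN
            ≡⟨ sym (∣0-x∣ (ℕq cN) (ℕq-nonneg cN)) ⟩
              ∣ 0ℚ - ℕq cN ∣
            ≡⟨ sym (+-identityʳ ∣ 0ℚ - ℕq cN ∣) ⟩
              ∣ 0ℚ - ℕq cN ∣ + 0ℚ
            ∎
          NO-mass≤ true false _ = subst (λ c → ℕq cN ≤q ∣ ℕq c - ℕq cN ∣ + ℕq c) (sym (ℕP.*-identityˡ cY)) (begin
              ℕq cN
            ≡⟨ sym (∣0-x∣ (ℕq cN) (ℕq-nonneg cN)) ⟩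
              ∣ 0ℚ - ℕq cN ∣
            ≤⟨ ∣-∣-triangle 0ℚ (ℕq cY) (ℕq cN) ⟩
              ∣ 0ℚ - ℕq cY ∣ + ∣ ℕq cY - ℕq cN ∣
            ≡⟨ trans (cong (_+ ∣ ℕq cY - ℕq cN ∣) (∣0-x∣ (ℕq cY) (ℕq-nonneg cY))) (+-comm (ℕq cY) ∣ ℕq cY - ℕq cN ∣) ⟩
              ∣ ℕq cY - ℕq cN ∣ + ℕq cY
            ∎)
          NO-mass≤ true true ()

        -- if the hybrid survives, the two processes move by kernels that are 2g-close
        survives : good j q M s ≡ true → nextEvent j p M s ≡ true → sumℚ (allFin k) distance′ ≤q budget true true
        survives eg eE = begin
            sumℚ (allFin k) distance′
          ≡⟨ sumℚ-cong (allFin k) both-move ⟩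
            sumℚ (allFin k) (λ σ → ∣ e * pY σ - f * pN σ ∣)
          ≤⟨ sumℚ-mono (allFin k) (λ σ → ∣-∣-product e f (pY σ) (pN σ) (ℕq-nonneg cY) (pN≥0 σ)) ⟩
            sumℚ (allFin k) (λ σ → ∣ e - f ∣ * pN σ + e * ∣ pY σ - pN σ ∣)
          ≡⟨ trans (sumℚ-+ (allFin k) _ _) (cong₂ _+_ (sumℚ-*ˡ ∣ e - f ∣ (allFin k) pN) (sumℚ-*ˡ e (allFin k) (λ σ → ∣ pY σ - pN σ ∣))) ⟩
            ∣ e - f ∣ * sumℚ (allFin k) pN + e * sumℚ (allFin k) (λ σ → ∣ pY σ - pN σ ∣)
          ≤⟨ +-mono-≤ (≤-mulˡ (0≤∣p∣ (e - f)) pN-total) (ℕq-*-bound cY _ (g + g) (kernels-close eE)) ⟩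
            ∣ e - f ∣ * 1ℚ + e * (g + g)
          ≡⟨ trans (cong₂ _+_ (*-identityʳ ∣ e - f ∣) (*-comm e (g + g))) (sym (+-identityʳ _)) ⟩
            ∣ e - f ∣ + (g + g) * e + 0ℚ
          ≡⟨ cong (λ c → ∣ ℕq c - f ∣ + (g + g) * e + 0ℚ) (sym (ℕP.*-identityˡ cY)) ⟩
            budget true true
          ∎
          where
          open ≤-Reasoning
          e f : ℚ
          e = ℕq cY
          f = ℕq cN
          both-move : (σ : Fin k) → distance′ σ ≡ ∣ e * pY σ - f * pN σ ∣
          both-move σ = trans (cong (λ b → ∣ ℕq (𝟙 b ℕ.* countY r (suc j) p M (s ∷ʳ σ)) - ℕq (countN r (suc j) p M (s ∷ʳ σ)) ∣)
                                    (trans (good-∷ʳ j p q M s σ) (cong₂ _∧_ eg eE)))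
                              (cong₂ (λ a b → ∣ a - b ∣) (trans (cong ℕq (ℕP.*-identityˡ (countY r (suc j) p M (s ∷ʳ σ)))) (chainY-ℚ σ)) (chainN-ℚ σ))

        one-round : sumℚ (allFin k) distance′ ≤q budget (good j q M s) (nextEvent j p M s)
        one-round = by-cases (good j q M s) (nextEvent j p M s) refl refl
          where
          by-cases : (b₁ b₂ : Bool) → good j q M s ≡ b₁ → nextEvent j p M s ≡ b₂ → sumℚ (allFin k) distance′ ≤q budget b₁ b₂
          by-cases true true eg eE = survives eg eE
          by-cases false b₂ eg eE = ≤-trans (killed (cong (_∧ nextEvent j p M s) eg)) (NO-mass≤budget false b₂ refl)
          by-cases true false eg eE = ≤-trans (killed (cong₂ _∧_ eg eE)) (NO-mass≤budget true false refl)


module HybridArgument where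

  -- With K = g·|Ω| and C = 2g·|Ω| + K:
  --   (1) at most K sample points leave the good events in each round
  --       (𝓔_1 is certain; afterwards Pr[¬𝓔_{t+1} | 𝓔_t] ≤ g), so at most T·K
  --       points are not good after T rounds;
  --   (2) summing the one-round estimate over all histories, the ℓ₁ distance
  --       D_j between the hybrid and the NO counts satisfies D_j ≤ j·C;
  --   (3) the YES counts differ from the hybrid only on non-good points, so
  --       Σ |countY − countN| ≤ T·K + T·C = 4·T·g·|Ω|,  i.e.  TVD ≤ 2·T·g.

  open import Data.Bool using (Bool; true; false; not; _∧_)
  open import Data.Nat as ℕ using (ℕ; zero; suc; _≤_; _<_)
  import Data.Nat.Properties as ℕP
  open import Data.Fin using (Fin; toℕ; fromℕ<)
  open import Data.Fin.Properties using (toℕ-fromℕ<) renaming (_≟_ to _≟F_)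
  open import Data.Integer using (+_)
  open import Data.Product using (proj₂)
  open import Data.List using (List; length; allFin)
  import Data.List.Relation.Unary.Unique.Propositional.Properties as Unique
  open import Data.Rational using (ℚ; 0ℚ; 1ℚ; ½; _/_; _+_; _*_; _-_; ∣_∣) renaming (_≤_ to _≤q_)
  open import Data.Rational.Properties using (≤-trans; ≤-reflexive; +-mono-≤; +-assoc; +-comm; +-identityʳ; +-inverseʳ; *-zeroˡ; *-identityˡ; *-identityʳ; *-distribʳ-+; 0≤p⇒∣p∣≡p)
  import Data.Rational.Properties as ℚP
  open import Data.Rational.Solver using (module +-*-Solver)
  open import Data.Vec as V using (Vec; [])
  import Data.Vec.Properties as VP
  open import Relation.Binary.PropositionalEquality
  open import Defs
  open Counting
  open BooleanEvents
  open Runs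
  open Rationals
  open ChainRule using (countY; countN)
  open TotalProbability
  open HybridProcess

  module _ {n m k T : ℕ} (r : Rounds n m k T) (E : Events n m k T) (g : ℚ) (g≥0 : 0ℚ ≤q g)
    (first-certain : (i : Fin T) → toℕ i ≡ 0 → Pr (allΩ n m T) (Eω r E i) ≡ 1ℚ)
    (step-tvd : (i : Fin T) (Mh : Vec (Matching n m) (suc (toℕ i))) (sh : Vec (Fin k) (toℕ i)) →
                E i Mh sh ≡ true → 0 < countᵇ (fixedHist r i Mh sh) (allΩ n m T) →
                tvd (allFin k) (condDistY r i Mh sh) (distN r i Mh sh) ≤q g)
    (escape : (i i′ : Fin T) → toℕ i′ ≡ suc (toℕ i) →
                PrCond (allΩ n m T) (λ ω → not (Eω r E i′ ω)) (Eω r E i) ≤q g)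
    where

    Ωl : List (Ω n m T)
    Ωl = allΩ n m T

    N : ℕ
    N = length Ωl

    Mlist : List (Vec (Matching n m) T)
    Mlist = allVecs (allMatchings n m) T

    Slist : (j : ℕ) → List (Vec (Fin k) j)
    Slist j = allVecs (allFin k) j

    K C : ℚ
    K = g * ℕq N
    C = (g + g) * ℕq N + K

    ℕq-suc-* : (j : ℕ) (X : ℚ) → ℕq j * X + X ≡ ℕq (suc j) * X
    ℕq-suc-* j X = sym (trans (cong (_* X) (ℕq-+ 1 j))
      (trans (*-distribʳ-+ X 1ℚ (ℕq j)) (trans (cong (_+ ℕq j * X) (*-identityˡ X)) (+-comm X _))))

    total-over-histories : (j : ℕ) (q : j ≤ T) (B : Vec (Matching n m) T → Vec (Fin k) j → Bool) →
      sumℕ Mlist (λ M → sumℕ (Slist j) (λ s → 𝟙 (B M s) ℕ.* countY r j q M s)) ≤ countᵇ (λ ω → B (Mof ω) (SY r ω j q)) Ωl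
    total-over-histories j q =
      total-probability Ωl Mlist (Slist j) _≟M_ (VP.≡-dec _≟F_) (matchingVecs-unique n m T) (allVecs-unique _ (Unique.allFin⁺ k) j)
                        Mof (λ ω → SY r ω j q)

    countY-total : (j : ℕ) (q : j ≤ T) → sumℕ Mlist (λ M → sumℕ (Slist j) (countY r j q M)) ≤ N
    countY-total j q = ℕP.≤-trans (ℕP.≤-reflexive (sym (sumℕ-cong Mlist (λ M → sumℕ-cong (Slist j) (λ s → ℕP.*-identityˡ (countY r j q M s))))))
                       (ℕP.≤-trans (total-over-histories j q (λ _ _ → true)) (count≤length _ Ωl))

    nextEvent-along : (j : ℕ) (p : suc j ≤ T) (q : j ≤ T) (ω : Ω n m T) → nextEvent r E j p (Mof ω) (SY r ω j q) ≡ Eω r E (fromℕ< p) ω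
    nextEvent-along j p q ω = cong (E (fromℕ< p) (Mhist ω (fromℕ< p)))
      (sym (family-cast (SY r ω) (λ a qa qa′ → run-irrelevant r (Mof ω) _ a qa qa′) (sym (toℕ-fromℕ< p)) q _))

    escaping : (j : ℕ) → suc j ≤ T → j ≤ T → ℕ
    escaping j p q = countᵇ (λ ω → badStep r E j p q (Mof ω) (SY r ω j q)) Ωl

    escaping-bound : (j : ℕ) (p : suc j ≤ T) (q : j ≤ T) → ℕq (escaping j p q) ≤q K
    escaping-bound zero p q = subst (_≤q K) (cong ℕq (sym none)) (0≤* g≥0 (ℕq-nonneg N))
      where
      i : Fin T
      i = fromℕ< p
      -- 𝓔_1 is certain, so its complement is empty
      none : escaping zero p q ≡ 0
      none = ℕP.n≤0⇒n≡0 (subst (escaping zero p q ≤_) complement-empty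
        (count-mono _ (λ ω → not (Eω r E i ω)) Ωl (λ ω h → trans (cong not (sym (nextEvent-along zero p q ω))) h)))
        where
        complement-empty : countᵇ (λ ω → not (Eω r E i ω)) Ωl ≡ 0
        complement-empty = ℕP.+-cancelˡ-≡ (countᵇ (Eω r E i) Ωl) _ 0
          (trans (count-complement (Eω r E i) Ωl) (trans (sym (proj₂ (ratio≡1 _ N (first-certain i (toℕ-fromℕ< p))))) (sym (ℕP.+-identityʳ _))))
    escaping-bound (suc j) p q = ≤-trans (ℕq-mono escaping≤leave)
      (ratio-bound leave (countᵇ (Eω r E i′) Ωl) N g g≥0 (count-mono _ _ Ωl (λ ω h → ∧-elimʳ _ _ h)) (count≤length _ Ωl)
        (escape i′ i (trans (toℕ-fromℕ< p) (cong suc (sym (toℕ-fromℕ< q))))))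
      where
      i i′ : Fin T
      i = fromℕ< p
      i′ = fromℕ< q
      q′ : j ≤ T
      q′ = ℕP.≤-trans (ℕP.n≤1+n j) q
      leave : ℕ
      leave = countᵇ (λ ω → not (Eω r E i ω) ∧ Eω r E i′ ω) Ωl
      escaping≤leave : escaping (suc j) p q ≤ leave
      escaping≤leave = count-mono _ _ Ωl leaves-from-𝓔
        where
        leaves-from-𝓔 : (ω : Ω n m T) → badStep r E (suc j) p q (Mof ω) (SY r ω (suc j) q) ≡ true →
                         (not (Eω r E i ω) ∧ Eω r E i′ ω) ≡ true
        leaves-from-𝓔 ω bad = ∧-intro (trans (cong not (sym (nextEvent-along (suc j) p q ω))) leaves) was-in-𝓔
          where
          sω : Vec (Fin k) (suc j)
          sω = SY r ω (suc j) q
          wasGood : good r E (suc j) q (Mof ω) sω ≡ true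
          wasGood = ∧-elimˡ (good r E (suc j) q (Mof ω) sω) (not (nextEvent r E (suc j) p (Mof ω) sω)) bad
          leaves : not (nextEvent r E (suc j) p (Mof ω) sω) ≡ true
          leaves = ∧-elimʳ (good r E (suc j) q (Mof ω) sω) (not (nextEvent r E (suc j) p (Mof ω) sω)) bad
          was-in-𝓔 : Eω r E i′ ω ≡ true
          was-in-𝓔 = trans (sym (trans (cong (nextEvent r E j q (Mof ω)) (VP.init-∷ʳ _ (SY r ω j q′))) (nextEvent-along j q q′ ω)))
                           (∧-elimʳ (good r E j q′ (Mof ω) (V.init sω)) _ wasGood)

    notGood : (j : ℕ) → j ≤ T → ℕ
    notGood j q = countᵇ (λ ω → not (good r E j q (Mof ω) (SY r ω j q))) Ωl

    notGood-bound : (j : ℕ) (q : j ≤ T) → ℕq (notGood j q) ≤q ℕq j * K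
    notGood-bound zero q = ≤-reflexive (trans (cong ℕq (count-false Ωl)) (sym (*-zeroˡ K)))
    notGood-bound (suc j) p = begin
        ℕq (notGood (suc j) p)
      ≤⟨ ℕq-mono (count-union (λ ω → good r E j q′ (Mof ω) (past ω)) (λ ω → nextEvent r E j p (Mof ω) (past ω)) Ωl) ⟩
        ℕq (countᵇ (λ ω → not (good r E j q′ (Mof ω) (past ω))) Ωl ℕ.+ countᵇ (λ ω → badStep r E j p q′ (Mof ω) (past ω)) Ωl)
      ≡⟨ cong ℕq (cong₂ ℕ._+_
           (count-cong _ _ Ωl (λ ω → cong (λ z → not (good r E j q′ (Mof ω) z)) (init-run ω)))
           (count-cong _ _ Ωl (λ ω → cong (badStep r E j p q′ (Mof ω)) (init-run ω)))) ⟩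
        ℕq (notGood j q′ ℕ.+ escaping j p q′)
      ≡⟨ ℕq-+ (notGood j q′) (escaping j p q′) ⟩
        ℕq (notGood j q′) + ℕq (escaping j p q′)
      ≤⟨ +-mono-≤ (notGood-bound j q′) (escaping-bound j p q′) ⟩
        ℕq j * K + K
      ≡⟨ ℕq-suc-* j K ⟩
        ℕq (suc j) * K
      ∎
      where
      open ℚP.≤-Reasoning
      q′ : j ≤ T
      q′ = ℕP.≤-trans (ℕP.n≤1+n j) p
      past : Ω n m T → Vec (Fin k) j
      past ω = V.init (SY r ω (suc j) p)
      init-run : (ω : Ω n m T) → past ω ≡ SY r ω j q′
      init-run ω = VP.init-∷ʳ _ (SY r ω j q′)

    D : (j : ℕ) → j ≤ T → ℚ
    D j q = sumℚ Mlist (λ M → sumℚ (Slist j) (λ s → ∣ ℕq (countŶ r E j q M s) - ℕq (countN r j q M s) ∣))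

    D-bound : (j : ℕ) (q : j ≤ T) → D j q ≤q ℕq j * C
    D-bound zero q = ≤-reflexive (trans (sumℚ-zero Mlist _ equal-at-start) (sym (*-zeroˡ C)))
      where
      -- before the first round both counts are  #{M(ω) = M}
      equal-at-start : (M : Vec (Matching n m) T) → sumℚ (Slist 0) (λ s → ∣ ℕq (countŶ r E 0 q M s) - ℕq (countN r 0 q M s) ∣) ≡ 0ℚ
      equal-at-start M = trans (+-identityʳ _) (trans (cong (λ z → ∣ ℕq z - ℕq (countN r 0 q M []) ∣) (ℕP.*-identityˡ (countY r 0 q M [])))
                           (cong ∣_∣ (+-inverseʳ (ℕq (countN r 0 q M [])))))
    D-bound (suc j) p = begin
        D (suc j) p
      ≡⟨ sumℚ-cong Mlist (λ M → sumℚ-allVecs-∷ʳ (allFin k) j _) ⟩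
        sumℚ Mlist (λ M → sumℚ (Slist j) (λ s → sumℚ (allFin k) (OneRound.distance′ r E g g≥0 step-tvd j p q M s)))
      ≤⟨ sumℚ-mono Mlist (λ M → sumℚ-mono (Slist j) (λ s → OneRound.one-round r E g g≥0 step-tvd j p q M s)) ⟩
        sumℚ Mlist (λ M → sumℚ (Slist j) (λ s → D₀ M s + (g + g) * ℕq (countY r j q M s) + ℕq (esc M s)))
      ≡⟨ trans (sumℚ-cong Mlist (λ M → sumℚ-+₃ (Slist j) _ _ _)) (sumℚ-+₃ Mlist _ _ _) ⟩
        D j q + sumℚ Mlist (λ M → sumℚ (Slist j) (λ s → (g + g) * ℕq (countY r j q M s))) + sumℚ Mlist (λ M → sumℚ (Slist j) (λ s → ℕq (esc M s)))
      ≡⟨ cong₂ (λ a b → D j q + a + b)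
           (trans (sumℚ-cong Mlist (λ M → trans (sumℚ-*ˡ (g + g) (Slist j) _) (cong ((g + g) *_) (sumℚ-ℕq (Slist j) _))))
                  (trans (sumℚ-*ˡ (g + g) Mlist _) (cong ((g + g) *_) (sumℚ-ℕq Mlist _))))
           (trans (sumℚ-cong Mlist (λ M → sumℚ-ℕq (Slist j) _)) (sumℚ-ℕq Mlist _)) ⟩
        D j q + (g + g) * ℕq (sumℕ Mlist (λ M → sumℕ (Slist j) (countY r j q M))) + ℕq (sumℕ Mlist (λ M → sumℕ (Slist j) (esc M)))
      ≤⟨ +-mono-≤ (+-mono-≤ (D-bound j q) (≤-mulˡ (0≤+ g≥0 g≥0) (ℕq-mono (countY-total j q))))
                  (≤-trans (ℕq-mono (total-over-histories j q (badStep r E j p q))) (escaping-bound j p q)) ⟩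
        ℕq j * C + (g + g) * ℕq N + K
      ≡⟨ trans (+-assoc (ℕq j * C) _ K) (ℕq-suc-* j C) ⟩
        ℕq (suc j) * C
      ∎
      where
      open ℚP.≤-Reasoning
      q : j ≤ T
      q = ℕP.≤-trans (ℕP.n≤1+n j) p
      D₀ : Vec (Matching n m) T → Vec (Fin k) j → ℚ
      D₀ M s = ∣ ℕq (countŶ r E j q M s) - ℕq (countN r j q M s) ∣
      esc : Vec (Matching n m) T → Vec (Fin k) j → ℕ
      esc M s = 𝟙 (badStep r E j p q M s) ℕ.* countY r j q M s

    ∣Y-Ŷ∣ : (b : Bool) (x : ℕ) → ∣ ℕq x - ℕq (𝟙 b ℕ.* x) ∣ ≡ ℕq (𝟙 (not b) ℕ.* x)
    ∣Y-Ŷ∣ true x = trans (cong (λ z → ∣ ℕq x - ℕq z ∣) (ℕP.*-identityˡ x)) (cong ∣_∣ (+-inverseʳ (ℕq x)))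
    ∣Y-Ŷ∣ false x = trans (cong ∣_∣ (+-identityʳ (ℕq x))) (trans (0≤p⇒∣p∣≡p (ℕq-nonneg x)) (cong ℕq (sym (ℕP.*-identityˡ x))))

    YES-NO-distance : sumℚ Mlist (λ M → sumℚ (Slist T) (λ s → ∣ ℕq (countY r T ℕP.≤-refl M s) - ℕq (countN r T ℕP.≤-refl M s) ∣))
                        ≤q ℕq T * K + ℕq T * C
    YES-NO-distance = begin
        sumℚ Mlist (λ M → sumℚ (Slist T) (λ s → ∣ Y M s - N′ M s ∣))
      ≤⟨ sumℚ-mono Mlist (λ M → sumℚ-mono (Slist T) (λ s → ∣-∣-triangle (Y M s) (Ŷ M s) (N′ M s))) ⟩
        sumℚ Mlist (λ M → sumℚ (Slist T) (λ s → ∣ Y M s - Ŷ M s ∣ + ∣ Ŷ M s - N′ M s ∣))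
      ≡⟨ trans (sumℚ-cong Mlist (λ M → sumℚ-+ (Slist T) _ _)) (sumℚ-+ Mlist _ _) ⟩
        sumℚ Mlist (λ M → sumℚ (Slist T) (λ s → ∣ Y M s - Ŷ M s ∣)) + D T ℕP.≤-refl
      ≡⟨ cong (_+ D T ℕP.≤-refl) (trans (sumℚ-cong Mlist (λ M → trans (sumℚ-cong (Slist T) (λ s → ∣Y-Ŷ∣ (goodT M s) (countY r T ℕP.≤-refl M s)))
                                                                      (sumℚ-ℕq (Slist T) _)))
                                        (sumℚ-ℕq Mlist _)) ⟩
        ℕq (sumℕ Mlist (λ M → sumℕ (Slist T) (λ s → 𝟙 (not (goodT M s)) ℕ.* countY r T ℕP.≤-refl M s))) + D T ℕP.≤-refl
      ≤⟨ +-mono-≤ (≤-trans (ℕq-mono (total-over-histories T ℕP.≤-refl (λ M s → not (goodT M s)))) (notGood-bound T ℕP.≤-refl))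
                  (D-bound T ℕP.≤-refl) ⟩
        ℕq T * K + ℕq T * C
      ∎
      where
      open ℚP.≤-Reasoning
      goodT : Vec (Matching n m) T → Vec (Fin k) T → Bool
      goodT = good r E T ℕP.≤-refl
      Y Ŷ N′ : Vec (Matching n m) T → Vec (Fin k) T → ℚ
      Y M s = ℕq (countY r T ℕP.≤-refl M s)
      Ŷ M s = ℕq (countŶ r E T ℕP.≤-refl M s)
      N′ M s = ℕq (countN r T ℕP.≤-refl M s)

    hybrid-bound : IsSuc N → tvd (jointSpace n m k T) (jointY r) (jointN r) ≤q (+ 2 / 1) * (ℕq T * g)
    hybrid-bound N>0 = begin
        ½ * sumℚ (jointSpace n m k T) (λ v → ∣ jointY r v - jointN r v ∣)
      ≡⟨ cong (½ *_) (sumℚ-× Mlist (Slist T) _) ⟩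
        ½ * sumℚ Mlist (λ M → sumℚ (Slist T) (λ s → ∣ ratio (cY M s) N - ratio (cN M s) N ∣))
      ≡⟨ cong (½ *_) (sumℚ-cong Mlist (λ M → sumℚ-cong (Slist T) (λ s → scale (cY M s) (cN M s)))) ⟩
        ½ * sumℚ Mlist (λ M → sumℚ (Slist T) (λ s → w * ∣ ℕq (cY M s) - ℕq (cN M s) ∣))
      ≡⟨ cong (½ *_) (trans (sumℚ-cong Mlist (λ M → sumℚ-*ˡ w (Slist T) _)) (sumℚ-*ˡ w Mlist _)) ⟩
        ½ * (w * sumℚ Mlist (λ M → sumℚ (Slist T) (λ s → ∣ ℕq (cY M s) - ℕq (cN M s) ∣)))
      ≤⟨ ≤-mulˡ (ratio-nonneg 1 2) (≤-mulˡ (ratio-nonneg 1 N) YES-NO-distance) ⟩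
        ½ * (w * (ℕq T * K + ℕq T * C))
      ≡⟨ solve 4 (λ t g n w → con ½ :* (w :* (t :* (g :* n) :+ t :* ((g :+ g) :* n :+ g :* n)))
                                := con (+ 2 / 1) :* (t :* g) :* (w :* n)) refl (ℕq T) g (ℕq N) w ⟩
        (+ 2 / 1) * (ℕq T * g) * (w * ℕq N)
      ≡⟨ trans (cong ((+ 2 / 1) * (ℕq T * g) *_) w*N≡1) (*-identityʳ _) ⟩
        (+ 2 / 1) * (ℕq T * g)
      ∎
      where
      open ℚP.≤-Reasoning
      open +-*-Solver
      w : ℚ
      w = ratio 1 N
      cY cN : Vec (Matching n m) T → Vec (Fin k) T → ℕ
      cY = countY r T ℕP.≤-refl
      cN = countN r T ℕP.≤-refl
      w*N≡1 : w * ℕq N ≡ 1ℚ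
      w*N≡1 = ratio-inverse N N>0
      scale : (a c : ℕ) → ∣ ratio a N - ratio c N ∣ ≡ w * ∣ ℕq a - ℕq c ∣
      scale a c = ∣ratio-ratio∣ a c N N>0


open import Defs
open import Data.Bool using (Bool; true; not)
open import Data.Nat using (ℕ; zero; suc; NonZero; _<_; ≢-nonZero⁻¹)
open import Data.Fin using (Fin; toℕ) renaming (zero to fzero)
open import Data.List using (allFin; length)
open import Data.Vec using (Vec)
open import Data.Integer using (+_)
open import Data.Rational using (ℚ; 0ℚ; 1ℚ; _≤_; _/_; _*_) renaming (_<_ to _<ℚ_)
open import Data.List.Membership.Propositional using (_∈_)
open import Relation.Binary.PropositionalEquality using (_≡_; refl; cong; trans)
open import Data.Product using (proj₁)
open import Data.Empty using (⊥-elim)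
open import Data.Rational.Properties using (<⇒≤; *-comm; *-assoc; *-identityʳ; module ≤-Reasoning)
open Rationals using (ℕq; IsSuc; ratio-cancel; ratio-nonneg; 0≤*; ratio≡1)
open HybridArgument using (hybrid-bound)

-- T = 0 is excluded by NonZero.
lemma14 : (n m k T : ℕ) .{{_ : NonZero T}} (γ : ℚ) → 0ℚ <ℚ γ →
          (r : Rounds n m k T) (E : Events n m k T) →
          ((i : Fin T) → toℕ i ≡ 0 → Pr (allΩ n m T) (Eω r E i) ≡ 1ℚ) →
          ((i i′ : Fin T) → toℕ i′ ≡ suc (toℕ i) → (ω : Ω n m T) → ω ∈ allΩ n m T →
            Eω r E i′ ω ≡ true → Eω r E i ω ≡ true) →
          ((i : Fin T) (Mh : Vec (Matching n m) (suc (toℕ i))) (sh : Vec (Fin k) (toℕ i)) →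
            E i Mh sh ≡ true → 0 < countᵇ (fixedHist r i Mh sh) (allΩ n m T) →
            tvd (allFin k) (condDistY r i Mh sh) (distN r i Mh sh) ≤ γ /ℕ T) →
          ((i i′ : Fin T) → toℕ i′ ≡ suc (toℕ i) →
            PrCond (allΩ n m T) (λ ω → not (Eω r E i′ ω)) (Eω r E i) ≤ γ /ℕ T) →
          tvd (jointSpace n m k T) (jointY r) (jointN r) ≤ (+ 2 / 1) * γ
lemma14 n m k zero {{T≢0}} _ _ _ _ _ _ _ _ = ⊥-elim (≢-nonZero⁻¹ 0 {{T≢0}} refl)
lemma14 n m k T@(suc t) γ γ>0 r E first-certain _ step-tvd escape = begin
    tvd (jointSpace n m k T) (jointY r) (jointN r)
  ≤⟨ hybrid-bound r E g g≥0 first-certain step-tvd escape Ω-nonempty ⟩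
    (+ 2 / 1) * (ℕq T * g)
  ≡⟨ cong ((+ 2 / 1) *_) T·γ/T≡γ ⟩
    (+ 2 / 1) * γ
  ∎
  where
  open ≤-Reasoning
  g : ℚ
  g = γ /ℕ T
  g≥0 : 0ℚ ≤ g
  g≥0 = 0≤* (<⇒≤ γ>0) (ratio-nonneg 1 T)
  T·γ/T≡γ : ℕq T * g ≡ γ
  T·γ/T≡γ = trans (*-comm (ℕq T) g) (trans (*-assoc γ (+ 1 / T) (ℕq T)) (trans (cong (γ *_) (ratio-cancel 1 t)) (*-identityʳ γ)))
  -- Pr[𝓔_1] = 1 forces the sample space to be non-empty
  Ω-nonempty : IsSuc (length (allΩ n m T))
  Ω-nonempty = proj₁ (ratio≡1 (countᵇ (Eω r E fzero) (allΩ n m T)) (length (allΩ n m T)) (first-certain fzero refl))
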